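{- For all positive integers $k$ and $d$, there is a graph $G$ that is the union of $d$ comparability graphs such that $\omega(G)=k$ and $\frac{|V(G)|}{\alpha(G)}=\chi_f(G)=\chi(G)=k^d$.
   Context: Graphs are finite and simple. For a graph $G$, $\omega(G)$ denotes the clique number (the maximum size of a clique in $G$), $\alpha(G)$ denotes the maximum size of an independent set in $G$, $\chi(G)$ denotes the chromatic number, and $\chi_f(G)$ denotes the fractional chromatic number, i.e. the minimum of $\sum_{I} w(I)$ over all assignments of nonnegative real weights $w(I)$ to the independent sets $I$ of $G$ such that $\sum_{I\ni v} w(I)\ge 1$ for every vertex $v$. A graph $G$ is the union of graphs $G_1,\ldots,G_d$ if $V(G)=V(G_1)\cup\cdots\cup V(G_d)$ and $E(G)=E(G_1)\cup\cdots\cup E(G_d)$. A comparability graph is a graph whose vertex set is a partially ordered set $(P,\preceq)$, where two (distinct) vertices are adjacent if and only if they are comparable in $(P,\preceq)$. -}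

module Defs where

open import Level using (Level; 0ℓ)
open import Data.Nat as ℕ using (ℕ; zero; suc)
import Data.Nat.Properties as ℕ
open import Data.Integer using (+_)
open import Data.Rational as ℚ using (ℚ; 0ℚ; 1ℚ; ½)
import Data.Rational.Properties as ℚ
open import Data.Rational.Solver using (module +-*-Solver)
open import Data.Fin using (Fin)
open import Data.Fin.Properties using (all?)
open import Data.Fin.Subset using (Subset; inside; outside; _∈_; _⊆_; ∣_∣)
open import Data.Fin.Subset.Properties using (_∈?_; _⊆?_)
open import Data.List using (List; []; _∷_; _++_; map; filter; foldr)
open import Data.Vec as Vec using ([]; _∷_)
open import Data.Product using (Σ; ∃-syntax; _×_; _,_; proj₁; proj₂)
open import Data.Sum using (_⊎_)
open import Function.Base using (flip)
open import Function.Bundles using (_⇔_)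
open import Relation.Binary using (Rel; Decidable; Symmetric; IsPartialOrder)
open import Relation.Binary.PropositionalEquality using (_≡_; _≢_; refl; sym; cong; subst)
open import Relation.Nullary using (¬_; Dec; ¬?; _×-dec_; _→-dec_)

private
  variable
    a ℓ p : Level

IsLeast : {A : Set a} → Rel A ℓ → (A → Set p) → A → Set _
IsLeast _≤_ P m = P m × (∀ x → P x → m ≤ x)

IsGreatest : {A : Set a} → Rel A ℓ → (A → Set p) → A → Set _
IsGreatest _≤_ = IsLeast (flip _≤_)

-- Real numbers, as Cauchy sequences of rationals.  Only the additive
-- ordered structure is developed; _≃_ is the equality of reals.

record ℝ : Set where
  field
    seq    : ℕ → ℚ
    cauchy : ∀ ε → 0ℚ ℚ.< ε →
             ∃[ N ] (∀ m n → N ℕ.≤ m → N ℕ.≤ n →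
                     ℚ.∣ seq m ℚ.- seq n ∣ ℚ.< ε)

open ℝ public using (seq)

infix  4 _≤_ _≃_
infixl 6 _+_

_≤_ : Rel ℝ 0ℓ
x ≤ y = ∀ ε → 0ℚ ℚ.< ε →
        ∃[ N ] (∀ n → N ℕ.≤ n → seq x n ℚ.≤ seq y n ℚ.+ ε)

_≃_ : Rel ℝ 0ℓ
x ≃ y = x ≤ y × y ≤ x

fromℚ : ℚ → ℝ
fromℚ q = record
  { seq    = λ _ → q
  ; cauchy = λ ε 0<ε → 0 , λ _ _ _ _ →
      subst (λ r → ℚ.∣ r ∣ ℚ.< ε) (sym (ℚ.+-inverseʳ q)) 0<ε
  }

fromℕ : ℕ → ℝ
fromℕ n = fromℚ (+ n ℚ./ 1)

_+_ : ℝ → ℝ → ℝ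
x + y = record
  { seq    = λ n → seq x n ℚ.+ seq y n
  ; cauchy = λ ε 0<ε →
      let 0<½ε    = subst (ℚ._< ½ ℚ.* ε) (ℚ.*-zeroʳ ½) (ℚ.*-monoʳ-<-pos ½ 0<ε)
          M , x-c = ℝ.cauchy x (½ ℚ.* ε) 0<½ε
          N , y-c = ℝ.cauchy y (½ ℚ.* ε) 0<½ε
      in M ℕ.⊔ N , λ m n m≥ n≥ →
        close (seq x m) (seq x n) (seq y m) (seq y n) ε
          (x-c m n (ℕ.≤-trans (ℕ.m≤m⊔n M N) m≥) (ℕ.≤-trans (ℕ.m≤m⊔n M N) n≥))
          (y-c m n (ℕ.≤-trans (ℕ.m≤n⊔m M N) m≥) (ℕ.≤-trans (ℕ.m≤n⊔m M N) n≥))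
  }
  where
  close : ∀ r s t u ε →
          ℚ.∣ r ℚ.- s ∣ ℚ.< ½ ℚ.* ε → ℚ.∣ t ℚ.- u ∣ ℚ.< ½ ℚ.* ε →
          ℚ.∣ (r ℚ.+ t) ℚ.- (s ℚ.+ u) ∣ ℚ.< ε
  close r s t u ε r-s t-u = begin-strict
    ℚ.∣ (r ℚ.+ t) ℚ.- (s ℚ.+ u) ∣       ≡⟨ cong ℚ.∣_∣ rearrange ⟩
    ℚ.∣ (r ℚ.- s) ℚ.+ (t ℚ.- u) ∣       ≤⟨ ℚ.∣p+q∣≤∣p∣+∣q∣ (r ℚ.- s) (t ℚ.- u) ⟩
    ℚ.∣ r ℚ.- s ∣ ℚ.+ ℚ.∣ t ℚ.- u ∣     <⟨ ℚ.+-mono-< r-s t-u ⟩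
    ½ ℚ.* ε ℚ.+ ½ ℚ.* ε                 ≡⟨ ℚ.*-distribʳ-+ ε ½ ½ ⟨
    1ℚ ℚ.* ε                            ≡⟨ ℚ.*-identityˡ ε ⟩
    ε                                   ∎
    where
    open ℚ.≤-Reasoning
    open +-*-Solver using (solve; _:+_; _:-_; _:=_)
    rearrange : (r ℚ.+ t) ℚ.- (s ℚ.+ u) ≡ (r ℚ.- s) ℚ.+ (t ℚ.- u)
    rearrange = solve 4 (λ r s t u →
      (r :+ t) :- (s :+ u) := (r :- s) :+ (t :- u)) refl r s t u

∑ : {A : Set a} → (A → ℝ) → List A → ℝ
∑ f xs = foldr _+_ (fromℕ 0) (map f xs)

-- Finite simple graphs.  The vertices form a subset of a finite universe
-- Fin N, so that graphs with different vertex sets can be united.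

record Graph (N : ℕ) : Set₁ where
  field
    V          : Subset N
    Adj        : Rel (Fin N) 0ℓ
    Adj?       : Decidable Adj
    Adj⇒∈V     : ∀ {x y} → Adj x y → x ∈ V
    Adj-sym    : Symmetric Adj
    Adj-irrefl : ∀ {x} → ¬ Adj x x

  Vertex : Set
  Vertex = ∃[ x ] x ∈ V

open Graph public using (V; Vertex)

private
  variable
    N : ℕ

IsComparabilityGraph : Graph N → Set₁
IsComparabilityGraph G =
  Σ (Rel (Vertex G) 0ℓ) λ _⪯_ →
    IsPartialOrder _≡_ _⪯_ ×
    (∀ u v → u ≢ v → Graph.Adj G (proj₁ u) (proj₁ v) ⇔ (u ⪯ v ⊎ v ⪯ u))

IsUnion : ∀ {d} → Graph N → (Fin d → Graph N) → Set
IsUnion G H =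
  (∀ x → x ∈ V G ⇔ (∃[ i ] x ∈ V (H i))) ×
  (∀ x y → Graph.Adj G x y ⇔ (∃[ i ] Graph.Adj (H i) x y))

Clique : Graph N → Subset N → Set
Clique G K = K ⊆ V G × (∀ x y → x ∈ K → y ∈ K → x ≢ y → Graph.Adj G x y)

Independent : Graph N → Subset N → Set
Independent G I = I ⊆ V G × (∀ x y → x ∈ I → y ∈ I → ¬ Graph.Adj G x y)

Colourable : Graph N → ℕ → Set
Colourable G c =
  Σ (Vertex G → Fin c) λ f →
    ∀ u v → Graph.Adj G (proj₁ u) (proj₁ v) → f u ≢ f v

IsCliqueNumber : Graph N → ℕ → Set
IsCliqueNumber G = IsGreatest ℕ._≤_ (λ m → ∃[ K ] Clique G K × ∣ K ∣ ≡ m)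

IsIndependenceNumber : Graph N → ℕ → Set
IsIndependenceNumber G =
  IsGreatest ℕ._≤_ (λ m → ∃[ I ] Independent G I × ∣ I ∣ ≡ m)

IsChromaticNumber : Graph N → ℕ → Set
IsChromaticNumber G = IsLeast ℕ._≤_ (Colourable G)

subsets : ∀ N → List (Subset N)
subsets zero    = [] ∷ []
subsets (suc N) =
  map (inside Vec.∷_) (subsets N) ++ map (outside Vec.∷_) (subsets N)

independent? : (G : Graph N) → ∀ I → Dec (Independent G I)
independent? G I =
  I ⊆? V G ×-dec
  all? λ x → all? λ y →
    (x ∈? I) →-dec ((y ∈? I) →-dec ¬? (Graph.Adj? G x y))

independentSets : Graph N → List (Subset N)
independentSets {N} G = filter (independent? G) (subsets N)

-- Weights are defined on all subsets, but only their values on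
-- independent sets are ever used.
IsFractionalColouring : Graph N → (Subset N → ℝ) → Set
IsFractionalColouring G w =
  (∀ I → Independent G I → fromℕ 0 ≤ w I) ×
  (∀ v → v ∈ V G → fromℕ 1 ≤ ∑ w (filter (v ∈?_) (independentSets G)))

IsFractionalChromaticNumber : Graph N → ℝ → Set
IsFractionalChromaticNumber G =
  IsLeast _≤_ λ r →
    ∃[ w ] IsFractionalColouring G w × ∑ w (independentSets G) ≃ r

{-# OPTIONS --safe #-}

-- Let W be the words of length D over ℤ/k, and let the vertices be pairs (w , c) of a word and a
-- colour c ∈ [k]^d.  Two vertices are joined in layer i when i is the first coordinate in which
-- their colours differ, say with values a and b there, and the reflected words s ↦ a − s and
-- s ↦ b − s are within Hamming distance |a − b| r.  Ordering layer i by the i-th coordinate of the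
-- colour, the triangle inequality gives transitivity, so each layer is a comparability graph.
--
-- ω = k: reflections with distinct a, b disagree everywhere, so for 3kr < D no triangle meets two
-- layers; hence a clique lies in one layer i and its i-th coordinates are distinct.
--
-- α = |W|: let I be independent and let A, B ⊆ W be its suitably reflected words of two given colours.
-- They are at distance at least r.  The Efron–Stein inequality applied to x ↦ max(0, r − d(x, A)) gives
-- r² |A| |B| ≤ 2 D |W| (|W| − |B|).  When r² ≥ 2 D k^(2d), a class of size more than |W| / k^d thus
-- leaves so little room for all the others that |I| ≤ |W|.
--
-- χ and χ_f: the k^d colour classes are independent of maximum size |W|, so double counting shows
-- that no (fractional) colouring beats the one by these classes.

module Submission where

open import Defs hiding (_+_; _≤_)
open import Algebra.Bundles using (CommutativeMonoid)
import Algebra.Properties.CommutativeMonoid.Sum as CommutativeMonoidSum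
import Algebra.Properties.Monoid.Mult as MonoidMult
open import Data.Bool as Bool using (Bool; true; false; not; if_then_else_; _∧_)
open import Data.Fin as Fin using (Fin; zero; suc; combine; remQuot; toℕ; fromℕ<; _↑ˡ_; _↑ʳ_)
import Data.Fin.Permutation as Perm
open import Data.Fin.Properties as Fin
  using (remQuot-combine; combine-remQuot; toℕ-injective; toℕ-fromℕ<; toℕ<n; any?; all?)
open import Data.Fin.Subset using (Subset; _∈_; _⊆_; ∣_∣; inside; outside; ⊤; ⁅_⁆)
open import Data.Fin.Subset.Properties
  using (_∈?_; ∈⊤; ∣⊤∣≡n; x∈⁅x⁆; ∣⁅x⁆∣≡1; p⊆q⇒∣p∣≤∣q∣; nonempty?; Empty-unique; ∣⊥∣≡0)
import Data.Integer as ℤ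
import Data.Integer.Properties as ℤ
open import Data.List using (List; []; _∷_; _++_; map; filter; foldr)
open import Data.List.Relation.Unary.All as All using (All; []; _∷_)
open import Data.List.Relation.Unary.All.Properties using (all-filter)
open import Data.Nat hiding (_/_)
open import Data.Nat.DivMod using (m%n<n; m%n%n≡m%n; %-distribˡ-+; [m+n]%n≡m%n; [m+kn]%n≡m%n; m<n⇒m%n≡m)
open import Data.Nat.Properties
open import Data.Nat.Tactic.RingSolver using (solve-∀)
open import Data.Product using (Σ; ∃-syntax; _×_; _,_; proj₁; proj₂)
open import Data.Rational as ℚ using (ℚ; 0ℚ; 1ℚ; ½; toℚᵘ)
import Data.Rational.Properties as ℚ
open import Data.Rational.Unnormalised as ℚᵘ using (mkℚᵘ; *≡*; *≤*)
import Data.Rational.Unnormalised.Properties as ℚᵘ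
open import Data.Sum using (_⊎_; inj₁; inj₂; [_,_]′)
open import Data.Vec as Vec using (Vec; []; _∷_; lookup; tabulate; replicate)
open import Data.Vec.Properties
  using (lookup∘tabulate; []=⇒lookup; lookup⇒[]=; lookup-replicate; map-replicate; ≡-dec)
open import Function.Base using (_∘_; case_of_)
open import Function.Bundles using (mk⇔)
open import Relation.Binary using (tri<; tri≈; tri>; IsPartialOrder)
open import Relation.Binary.PropositionalEquality
open import Relation.Nullary using (Dec; yes; no; does; contradiction; ¬_; ¬?; _×-dec_; _→-dec_)
open import Relation.Nullary.Decidable using (dec-true; dec-false)
open import Relation.Unary using (Pred; Decidable)
open import Algebra.Properties.CommutativeSemigroup +-commutativeSemigroup using (interchange)
open import Algebra.Properties.CommutativeSemigroup
  (CommutativeMonoid.commutativeSemigroup ℚ.+-0-commutativeMonoid) using () renaming (interchange to ℚ-interchange)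
open import Algebra.Properties.Semiring.Sum +-*-semiring
  using (sum; sum-syntax; sum-cong-≗; sum-replicate-zero; ∑-distrib-+; ∑-comm; *-distribˡ-sum; *-distribʳ-sum; sum-permute)

-- Finite sums of natural numbers.

∑-mono : ∀ {n} {f g : Fin n → ℕ} → (∀ i → f i ≤ g i) → sum f ≤ sum g
∑-mono {zero}  f≤g = z≤n
∑-mono {suc n} f≤g = +-mono-≤ (f≤g zero) (∑-mono (f≤g ∘ suc))

∑-const : ∀ n c → ∑[ i < n ] c ≡ n * c
∑-const zero    c = refl
∑-const (suc n) c = cong (c +_) (∑-const n c)

∑-term : ∀ {n} (f : Fin n → ℕ) i → f i ≤ sum f
∑-term f zero    = m≤m+n _ _
∑-term f (suc i) = ≤-trans (∑-term (f ∘ suc) i) (m≤n+m _ _)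

∑-++ : ∀ m n (f : Fin (m + n) → ℕ) →
       sum f ≡ ∑[ i < m ] f (i ↑ˡ n) + ∑[ j < n ] f (m ↑ʳ j)
∑-++ zero    n f = refl
∑-++ (suc m) n f = trans (cong (f zero +_) (∑-++ m n (f ∘ suc)))
                         (sym (+-assoc (f zero) _ _))

∑-combine : ∀ m n (f : Fin (m * n) → ℕ) →
            sum f ≡ ∑[ i < m ] ∑[ j < n ] f (combine i j)
∑-combine zero    n f = refl
∑-combine (suc m) n f = trans (∑-++ n (m * n) f)
                              (cong (∑[ j < n ] f (j ↑ˡ (m * n)) +_) (∑-combine m n (f ∘ (n ↑ʳ_))))

-- Sums of squared differences

sq : ℕ → ℕ → ℕ
sq m n = ∣ m - n ∣ * ∣ m - n ∣

sq-comm : ∀ m n → sq m n ≡ sq n m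
sq-comm m n = cong (λ x → x * x) (∣-∣-comm m n)

sq+2mn : ∀ m n → sq m n + 2 * (m * n) ≡ m * m + n * n
sq+2mn m n = [ below , flipped ]′ (≤-total m n)
  where
  below : ∀ {m n} → m ≤ n → sq m n + 2 * (m * n) ≡ m * m + n * n
  below {m} m≤n with o , refl ← m≤n⇒∃[o]m+o≡n m≤n
    rewrite ∣m-m+n∣≡n m o = identity m o
    where
    identity : ∀ m o → o * o + 2 * (m * (m + o)) ≡ m * m + (m + o) * (m + o)
    identity = solve-∀
  flipped : n ≤ m → sq m n + 2 * (m * n) ≡ m * m + n * n
  flipped n≤m = trans (cong₂ _+_ (sq-comm m n) (cong (2 *_) (*-comm m n)))
                      (trans (below n≤m) (+-comm (n * n) (m * m)))

-- The defect is the square of p + v - (q + u).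
quadrilateral : ∀ p q u v →
  sq p v + sq q u ≤ (sq p q + sq u v) + (sq p u + sq q v)
quadrilateral p q u v = ≤-trans (m≤m+n _ (sq (p + v) (q + u))) (≤-reflexive
  (+-cancelʳ-≡ c _ _ (begin
    sq p v + sq q u + s + c
      ≡⟨ regroupˡ p q u v (sq p v) (sq q u) s ⟩
    (sq p v + 2 * (p * v)) + (sq q u + 2 * (q * u)) + (s + 2 * ((p + v) * (q + u)))
      ≡⟨ cong₂ _+_ (cong₂ _+_ (sq+2mn p v) (sq+2mn q u)) (sq+2mn (p + v) (q + u)) ⟩
    (p * p + v * v) + (q * q + u * u) + ((p + v) * (p + v) + (q + u) * (q + u))
      ≡⟨ middle p q u v ⟩
    ((p * p + q * q) + (u * u + v * v)) + ((p * p + u * u) + (q * q + v * v))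
      + 2 * (p * v + q * u)
      ≡⟨ cong (_+ 2 * (p * v + q * u))
           (cong₂ _+_ (cong₂ _+_ (sq+2mn p q) (sq+2mn u v))
                      (cong₂ _+_ (sq+2mn p u) (sq+2mn q v))) ⟨
    ((sq p q + 2 * (p * q)) + (sq u v + 2 * (u * v)))
      + ((sq p u + 2 * (p * u)) + (sq q v + 2 * (q * v))) + 2 * (p * v + q * u)
      ≡⟨ regroupʳ p q u v (sq p q) (sq u v) (sq p u) (sq q v) ⟩
    (sq p q + sq u v) + (sq p u + sq q v) + c ∎)))
  where
  open ≡-Reasoning
  s = sq (p + v) (q + u)
  -- `c` collects the cross terms of the three squares on the left; adding it to both sides lets
  -- `sq+2mn` expand every square without subtraction. On the right its second summand is used up,
  -- because `(p + v) * (q + u)` is the sum of the four products needed there.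
  c = 2 * (p * v + q * u) + 2 * ((p + v) * (q + u))
  regroupˡ : ∀ p q u v a b s →
    a + b + s + (2 * (p * v + q * u) + 2 * ((p + v) * (q + u))) ≡
    (a + 2 * (p * v)) + (b + 2 * (q * u)) + (s + 2 * ((p + v) * (q + u)))
  regroupˡ = solve-∀
  middle : ∀ p q u v →
    (p * p + v * v) + (q * q + u * u) + ((p + v) * (p + v) + (q + u) * (q + u)) ≡
    ((p * p + q * q) + (u * u + v * v)) + ((p * p + u * u) + (q * q + v * v))
      + 2 * (p * v + q * u)
  middle = solve-∀
  regroupʳ : ∀ p q u v a b c d →
    ((a + 2 * (p * q)) + (b + 2 * (u * v))) + ((c + 2 * (p * u)) + (d + 2 * (q * v)))
      + 2 * (p * v + q * u) ≡
    (a + b) + (c + d) + (2 * (p * v + q * u) + 2 * ((p + v) * (q + u)))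
  regroupʳ = solve-∀

∑⁴ : ∀ {p q} → (Fin p → Fin p → Fin q → Fin q → ℕ) → ℕ
∑⁴ {p} {q} f = ∑[ s < p ] ∑[ t < p ] ∑[ x < q ] ∑[ y < q ] f s t x y

module _ {p q : ℕ} where

  ∑⁴-mono : {f g : Fin p → Fin p → Fin q → Fin q → ℕ} →
            (∀ s t x y → f s t x y ≤ g s t x y) → ∑⁴ f ≤ ∑⁴ g
  ∑⁴-mono f≤g = ∑-mono λ s → ∑-mono λ t → ∑-mono λ x → ∑-mono λ y → f≤g s t x y

  ∑⁴-+ : ∀ (f g : Fin p → Fin p → Fin q → Fin q → ℕ) →
         ∑⁴ (λ s t x y → f s t x y + g s t x y) ≡ ∑⁴ f + ∑⁴ g
  ∑⁴-+ f g = trans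
    (sum-cong-≗ λ s → trans
      (sum-cong-≗ λ t → trans
        (sum-cong-≗ λ x → ∑-distrib-+ (f s t x) (g s t x))
        (∑-distrib-+ (λ x → sum (f s t x)) (λ x → sum (g s t x))))
      (∑-distrib-+ (λ t → ∑[ x < q ] sum (f s t x)) (λ t → ∑[ x < q ] sum (g s t x))))
    (∑-distrib-+ (λ s → ∑[ t < p ] ∑[ x < q ] sum (f s t x))
                 (λ s → ∑[ t < p ] ∑[ x < q ] sum (g s t x)))

  ∑⁴-swapˡ : ∀ (f : Fin p → Fin p → Fin q → Fin q → ℕ) →
             ∑⁴ (λ s t x y → f t s x y) ≡ ∑⁴ f
  ∑⁴-swapˡ f = ∑-comm λ s t → ∑[ x < q ] ∑[ y < q ] f t s x y

  ∑⁴-swapʳ : ∀ (f : Fin p → Fin p → Fin q → Fin q → ℕ) →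
             ∑⁴ (λ s t x y → f s t y x) ≡ ∑⁴ f
  ∑⁴-swapʳ f = sum-cong-≗ λ s → sum-cong-≗ λ t → ∑-comm λ x y → f s t y x

  module _ (g : Fin p → Fin q → ℕ) where

    columns rows : ℕ
    columns = ∑[ s < p ] ∑[ t < p ] ∑[ x < q ] sq (g s x) (g t x)
    rows    = ∑[ s < p ] ∑[ x < q ] ∑[ y < q ] sq (g s x) (g s y)

    private
      ∑⁴-columns : ∑⁴ (λ s t x y → sq (g s x) (g t x)) ≡ q * columns
      ∑⁴-columns = sym (begin
        q * columns
          ≡⟨ *-distribˡ-sum q (λ s → ∑[ t < p ] ∑[ x < q ] sq (g s x) (g t x)) ⟩
        ∑[ s < p ] (q * (∑[ t < p ] ∑[ x < q ] sq (g s x) (g t x)))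
          ≡⟨ (sum-cong-≗ λ s → *-distribˡ-sum q (λ t → ∑[ x < q ] sq (g s x) (g t x))) ⟩
        ∑[ s < p ] ∑[ t < p ] (q * (∑[ x < q ] sq (g s x) (g t x)))
          ≡⟨ (sum-cong-≗ λ s → sum-cong-≗ λ t → *-distribˡ-sum q (λ x → sq (g s x) (g t x))) ⟩
        ∑[ s < p ] ∑[ t < p ] ∑[ x < q ] (q * sq (g s x) (g t x))
          ≡⟨ (sum-cong-≗ λ s → sum-cong-≗ λ t → sum-cong-≗ λ x → ∑-const q (sq (g s x) (g t x))) ⟨
        ∑⁴ (λ s t x y → sq (g s x) (g t x)) ∎)
        where open ≡-Reasoning

      ∑⁴-rows : ∑⁴ (λ s t x y → sq (g s x) (g s y)) ≡ p * rows
      ∑⁴-rows = begin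
        ∑⁴ (λ s t x y → sq (g s x) (g s y))
          ≡⟨ (sum-cong-≗ λ s → ∑-const p (∑[ x < q ] ∑[ y < q ] sq (g s x) (g s y))) ⟩
        ∑[ s < p ] (p * (∑[ x < q ] ∑[ y < q ] sq (g s x) (g s y)))
          ≡⟨ *-distribˡ-sum p (λ s → ∑[ x < q ] ∑[ y < q ] sq (g s x) (g s y)) ⟨
        p * rows ∎
        where open ≡-Reasoning

    -- Apply `quadrilateral` to the four entries of the matrix `g` in rows `s`, `t` and columns `x`,
    -- `y`, and sum. The two diagonals have equal totals after exchanging `s` and `t`, and opposite
    -- sides have equal totals likewise, which gives the common factor 2. This is the tensorisation
    -- step for a product of two factors.
    ∑-quadrilateral : ∑⁴ (λ s t x y → sq (g s x) (g t y)) ≤ q * columns + p * rows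
    ∑-quadrilateral = *-cancelˡ-≤ 2 (begin
      2 * ∑⁴ diagonal
        ≡⟨ cong (∑⁴ diagonal +_) (trans (+-identityʳ _) (sym (∑⁴-swapˡ diagonal))) ⟩
      ∑⁴ diagonal + ∑⁴ (λ s t x y → diagonal t s x y)
        ≡⟨ ∑⁴-+ diagonal (λ s t x y → diagonal t s x y) ⟨
      ∑⁴ (λ s t x y → diagonal s t x y + diagonal t s x y)
        ≤⟨ ∑⁴-mono (λ s t x y → quadrilateral (g s x) (g t x) (g s y) (g t y)) ⟩
      ∑⁴ (λ s t x y → (column s t x y + column s t y x) + (row s t x y + row t s x y))
        ≡⟨ ∑⁴-+ (λ s t x y → column s t x y + column s t y x)
                (λ s t x y → row s t x y + row t s x y) ⟩
      ∑⁴ (λ s t x y → column s t x y + column s t y x) + ∑⁴ (λ s t x y → row s t x y + row t s x y)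
        ≡⟨ cong₂ _+_ (∑⁴-+ column (λ s t x y → column s t y x))
                     (∑⁴-+ row (λ s t x y → row t s x y)) ⟩
      (∑⁴ column + ∑⁴ (λ s t x y → column s t y x)) + (∑⁴ row + ∑⁴ (λ s t x y → row t s x y))
        ≡⟨ cong₂ _+_ (cong₂ _+_ ∑⁴-columns (trans (∑⁴-swapʳ column) ∑⁴-columns))
                     (cong₂ _+_ ∑⁴-rows (trans (∑⁴-swapˡ row) ∑⁴-rows)) ⟩
      (q * columns + q * columns) + (p * rows + p * rows)
        ≡⟨ regroup (q * columns) (p * rows) ⟩
      2 * (q * columns + p * rows) ∎)
      where
      open ≤-Reasoning
      diagonal column row : Fin p → Fin p → Fin q → Fin q → ℕ
      diagonal s t x y = sq (g s x) (g t y)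
      column   s t x y = sq (g s x) (g t x)
      row      s t x y = sq (g s x) (g s y)
      regroup : ∀ a b → (a + a) + (b + b) ≡ 2 * (a + b)
      regroup = solve-∀

-- Words and the Efron–Stein inequality

module _ {k : ℕ} where

  word : ∀ D → Fin (k ^ D) → Vec (Fin k) D
  word zero    i = []
  word (suc D) i = proj₁ (remQuot {k} (k ^ D) i) ∷ word D (proj₂ (remQuot {k} (k ^ D) i))

  word-combine : ∀ {D} s (i : Fin (k ^ D)) → word (suc D) (combine s i) ≡ s ∷ word D i
  word-combine {D} s i = cong (λ p → proj₁ p ∷ word D (proj₂ p)) (remQuot-combine {k} {k ^ D} s i)

  index : ∀ {D} → Vec (Fin k) D → Fin (k ^ D)
  index []      = zero
  index (s ∷ w) = combine s (index w)

  word-index : ∀ {D} (w : Vec (Fin k) D) → word D (index w) ≡ w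
  word-index []      = refl
  word-index (s ∷ w) = trans (word-combine s (index w)) (cong (s ∷_) (word-index w))

  ∑ʷ : ∀ D → (Vec (Fin k) D → ℕ) → ℕ
  ∑ʷ D f = ∑[ i < k ^ D ] f (word D i)

  ∑ʷ-suc : ∀ D (f : Vec (Fin k) (suc D) → ℕ) → ∑ʷ (suc D) f ≡ ∑[ s < k ] ∑ʷ D (f ∘ (s ∷_))
  ∑ʷ-suc D f = trans (∑-combine k (k ^ D) (f ∘ word (suc D)))
    (sum-cong-≗ λ s → sum-cong-≗ λ i → cong f (word-combine s i))

  ∑ʷ-map : ∀ (π : Perm.Permutation k k) D (f : Vec (Fin k) D → ℕ) →
           ∑ʷ D (f ∘ Vec.map (π Perm.⟨$⟩ʳ_)) ≡ ∑ʷ D f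
  ∑ʷ-map π zero    f = refl
  ∑ʷ-map π (suc D) f = begin
    ∑ʷ (suc D) (f ∘ Vec.map σ)                      ≡⟨ ∑ʷ-suc D (f ∘ Vec.map σ) ⟩
    ∑[ s < k ] ∑ʷ D (f ∘ (σ s ∷_) ∘ Vec.map σ)      ≡⟨ (sum-cong-≗ λ s → ∑ʷ-map π D (f ∘ (σ s ∷_))) ⟩
    ∑[ s < k ] ∑ʷ D (f ∘ (σ s ∷_))                  ≡⟨ sum-permute (λ s → ∑ʷ D (f ∘ (s ∷_))) π ⟨
    ∑[ s < k ] ∑ʷ D (f ∘ (s ∷_))                    ≡⟨ ∑ʷ-suc D f ⟨
    ∑ʷ (suc D) f                                    ∎
    where
    open ≡-Reasoning
    σ = π Perm.⟨$⟩ʳ_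

  mismatch : Fin k → Fin k → ℕ
  mismatch s t = if does (s Fin.≟ t) then 0 else 1

  mismatch-≡ : ∀ {s t} → s ≡ t → mismatch s t ≡ 0
  mismatch-≡ {s} {t} s≡t with s Fin.≟ t
  ... | yes _  = refl
  ... | no s≢t = contradiction s≡t s≢t

  mismatch-≢ : ∀ {s t} → s ≢ t → mismatch s t ≡ 1
  mismatch-≢ {s} {t} s≢t with s Fin.≟ t
  ... | yes s≡t = contradiction s≡t s≢t
  ... | no _    = refl

  mismatch≤1 : ∀ s t → mismatch s t ≤ 1
  mismatch≤1 s t with s Fin.≟ t
  ... | yes _ = z≤n
  ... | no _  = ≤-refl

  mismatch-sym : ∀ s t → mismatch s t ≡ mismatch t s
  mismatch-sym s t with s Fin.≟ t
  ... | yes s≡t = sym (mismatch-≡ (sym s≡t))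
  ... | no s≢t  = sym (mismatch-≢ (s≢t ∘ sym))

  mismatch-triangle : ∀ s t u → mismatch s u ≤ mismatch s t + mismatch t u
  mismatch-triangle s t u with s Fin.≟ t
  ... | yes refl = ≤-refl
  ... | no _     = ≤-trans (mismatch≤1 s u) (m≤m+n 1 _)

  hamming : ∀ {D} → Vec (Fin k) D → Vec (Fin k) D → ℕ
  hamming []      []      = 0
  hamming (s ∷ x) (t ∷ y) = mismatch s t + hamming x y

  hamming-refl : ∀ {D} (x : Vec (Fin k) D) → hamming x x ≡ 0
  hamming-refl []      = refl
  hamming-refl (s ∷ x) = cong₂ _+_ (mismatch-≡ {s} refl) (hamming-refl x)

  hamming-sym : ∀ {D} (x y : Vec (Fin k) D) → hamming x y ≡ hamming y x
  hamming-sym []      []      = refl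
  hamming-sym (s ∷ x) (t ∷ y) = cong₂ _+_ (mismatch-sym s t) (hamming-sym x y)

  hamming-triangle : ∀ {D} (x y z : Vec (Fin k) D) → hamming x z ≤ hamming x y + hamming y z
  hamming-triangle []      []      []      = z≤n
  hamming-triangle (s ∷ x) (t ∷ y) (u ∷ z) = begin
    mismatch s u + hamming x z
      ≤⟨ +-mono-≤ (mismatch-triangle s t u) (hamming-triangle x y z) ⟩
    (mismatch s t + mismatch t u) + (hamming x y + hamming y z)
      ≡⟨ interchange (mismatch s t) _ _ _ ⟩
    (mismatch s t + hamming x y) + (mismatch t u + hamming y z) ∎
    where open ≤-Reasoning

  -- ∑ᵢ ∑ₓ ∑ₜ sq (f x) (f (x [ i ]≔ t)).
  energy : ∀ D → (Vec (Fin k) D → ℕ) → ℕ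
  energy zero    f = 0
  energy (suc D) f = columns (λ s i → f (s ∷ word D i)) + ∑[ s < k ] energy D (f ∘ (s ∷_))

  -- Divided by `k ^ (2 * D + 1)`, both sides are averages: the mean squared difference at two
  -- independent words is at most the sum, over the coordinates, of the mean squared change when
  -- that letter is resampled. In the induction `∑-quadrilateral` splits off the first letter; its
  -- columns are the energy in that letter, and its rows are pair sums over tails.
  efron-stein : ∀ D (f : Vec (Fin k) D → ℕ) →
    k * ∑ʷ D (λ x → ∑ʷ D λ y → sq (f x) (f y)) ≤ k ^ D * energy D f
  efron-stein zero    f = ≤-reflexive (trans (cong (λ z → k * (z * z + 0 + 0)) (∣n-n∣≡0 (f []))) (*-zeroʳ k))
  efron-stein (suc D) f = begin
    k * ∑ʷ (suc D) (λ x → ∑ʷ (suc D) λ y → sq (f x) (f y))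
      ≡⟨ cong (k *_) unfold ⟩
    k * ∑⁴ (λ s t i j → sq (g s i) (g t j))
      ≤⟨ *-monoʳ-≤ k (∑-quadrilateral g) ⟩
    k * (k ^ D * columns g + k * rows g)
      ≡⟨ cong (λ z → k * (k ^ D * columns g + z))
              (*-distribˡ-sum k (λ s → ∑ʷ D λ x → ∑ʷ D λ y → sq (f (s ∷ x)) (f (s ∷ y)))) ⟩
    k * (k ^ D * columns g + (∑[ s < k ] (k * ∑ʷ D λ x → ∑ʷ D λ y → sq (f (s ∷ x)) (f (s ∷ y)))))
      ≤⟨ *-monoʳ-≤ k (+-monoʳ-≤ (k ^ D * columns g) (∑-mono λ s → efron-stein D (f ∘ (s ∷_)))) ⟩
    k * (k ^ D * columns g + (∑[ s < k ] (k ^ D * energy D (f ∘ (s ∷_)))))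
      ≡⟨ cong (λ z → k * (k ^ D * columns g + z))
              (*-distribˡ-sum (k ^ D) (λ s → energy D (f ∘ (s ∷_)))) ⟨
    k * (k ^ D * columns g + k ^ D * (∑[ s < k ] energy D (f ∘ (s ∷_))))
      ≡⟨ factor k (k ^ D) (columns g) _ ⟩
    k ^ suc D * energy (suc D) f ∎
    where
    open ≤-Reasoning
    g : Fin k → Fin (k ^ D) → ℕ
    g s i = f (s ∷ word D i)
    factor : ∀ a b c e → a * (b * c + b * e) ≡ a * b * (c + e)
    factor = solve-∀
    unfold : ∑ʷ (suc D) (λ x → ∑ʷ (suc D) λ y → sq (f x) (f y)) ≡ ∑⁴ (λ s t i j → sq (g s i) (g t j))
    unfold = trans (∑ʷ-suc D λ x → ∑ʷ (suc D) λ y → sq (f x) (f y))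
      (sum-cong-≗ λ s → trans
        (sum-cong-≗ λ i → ∑ʷ-suc D λ y → sq (g s i) (f y))
        (∑-comm λ i t → ∑[ j < k ^ D ] sq (g s i) (g t j)))

  -- The energy runs over ordered pairs of words with a marked coordinate outside of which they
  -- agree. Each word occurs `D * k` times as the first entry and as often as the second, hence the
  -- factor `D * (2 * k)`.
  energy-≤ : ∀ D (f g : Vec (Fin k) D → ℕ) →
    (∀ x y → hamming x y ≤ 1 → sq (f x) (f y) ≤ g x + g y) →
    energy D f ≤ D * (2 * k * ∑ʷ D g)
  energy-≤ zero    f g local = z≤n
  energy-≤ (suc D) f g local = begin
    columns (λ s i → f (s ∷ word D i)) + ∑[ s < k ] energy D (f ∘ (s ∷_))
      ≤⟨ +-mono-≤
           (∑-mono λ s → ∑-mono λ t → ∑-mono λ i → local (s ∷ word D i) (t ∷ word D i) (head-step s t (word D i)))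
           (∑-mono λ s → energy-≤ D (f ∘ (s ∷_)) (g ∘ (s ∷_)) λ x y → local (s ∷ x) (s ∷ y) ∘ tail-step s x y) ⟩
    (∑[ s < k ] ∑[ t < k ] ∑[ i < k ^ D ] (g (s ∷ word D i) + g (t ∷ word D i)))
      + ∑[ s < k ] (D * (2 * k * ∑ʷ D (g ∘ (s ∷_))))
      ≡⟨ cong₂ _+_ pairs tails ⟩
    2 * k * G + D * (2 * k * G) ∎
    where
    open ≤-Reasoning
    G = ∑ʷ (suc D) g
    head-step : ∀ s t (x : Vec (Fin k) D) → hamming (s ∷ x) (t ∷ x) ≤ 1
    head-step s t x = subst (λ h → mismatch s t + h ≤ 1) (sym (hamming-refl x))
      (subst (_≤ 1) (sym (+-identityʳ _)) (mismatch≤1 s t))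
    tail-step : ∀ s (x y : Vec (Fin k) D) → hamming x y ≤ 1 → hamming (s ∷ x) (s ∷ y) ≤ 1
    tail-step s x y = subst (_≤ 1) (sym (cong (_+ hamming x y) (mismatch-≡ {s} refl)))
    u : Fin k → ℕ
    u s = ∑ʷ D (g ∘ (s ∷_))
    double : ∀ a b → a * b + a * b ≡ 2 * a * b
    double = solve-∀
    pairs : ∑[ s < k ] ∑[ t < k ] ∑[ i < k ^ D ] (g (s ∷ word D i) + g (t ∷ word D i)) ≡ 2 * k * G
    pairs = begin-equality
      ∑[ s < k ] ∑[ t < k ] ∑[ i < k ^ D ] (g (s ∷ word D i) + g (t ∷ word D i))
        ≡⟨ (sum-cong-≗ λ s → sum-cong-≗ λ t → ∑-distrib-+ (λ i → g (s ∷ word D i)) (λ i → g (t ∷ word D i))) ⟩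
      ∑[ s < k ] ∑[ t < k ] (u s + u t)
        ≡⟨ (sum-cong-≗ λ s → ∑-distrib-+ (λ t → u s) u) ⟩
      ∑[ s < k ] ((∑[ t < k ] u s) + sum u)
        ≡⟨ ∑-distrib-+ (λ s → ∑[ t < k ] u s) (λ s → sum u) ⟩
      ∑[ s < k ] ∑[ t < k ] u s + ∑[ s < k ] sum u
        ≡⟨ cong₂ _+_ (trans (sum-cong-≗ λ s → ∑-const k (u s)) (sym (*-distribˡ-sum k u))) (∑-const k (sum u)) ⟩
      k * sum u + k * sum u
        ≡⟨ double k (sum u) ⟩
      2 * k * sum u
        ≡⟨ cong (2 * k *_) (∑ʷ-suc D g) ⟨
      2 * k * G ∎
    tails : ∑[ s < k ] (D * (2 * k * u s)) ≡ D * (2 * k * G)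
    tails = begin-equality
      ∑[ s < k ] (D * (2 * k * u s))   ≡⟨ *-distribˡ-sum D (λ s → 2 * k * u s) ⟨
      D * (∑[ s < k ] (2 * k * u s))   ≡⟨ cong (D *_) (*-distribˡ-sum (2 * k) u) ⟨
      D * (2 * k * sum u)              ≡⟨ cong (λ z → D * (2 * k * z)) (∑ʷ-suc D g) ⟨
      D * (2 * k * G)                  ∎

-- Distant sets of words

⨆ : ∀ {n} → (Fin n → ℕ) → ℕ
⨆ {zero}  f = 0
⨆ {suc n} f = f zero ⊔ ⨆ (f ∘ suc)

⨆-upper : ∀ {n} (f : Fin n → ℕ) i → f i ≤ ⨆ f
⨆-upper f zero    = m≤m⊔n _ _
⨆-upper f (suc i) = ≤-trans (⨆-upper (f ∘ suc) i) (m≤n⊔m (f zero) _)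

⨆-least : ∀ {n} {f : Fin n → ℕ} {b} → (∀ i → f i ≤ b) → ⨆ f ≤ b
⨆-least {zero}  f≤b = z≤n
⨆-least {suc n} f≤b = ⊔-lub (f≤b zero) (⨆-least (f≤b ∘ suc))

𝟙 : Bool → ℕ
𝟙 b = if b then 1 else 0

𝟙-not : ∀ b → 𝟙 b + 𝟙 (not b) ≡ 1
𝟙-not true  = refl
𝟙-not false = refl

module _ {k D : ℕ} .{{_ : NonZero k}} where

  size : (Vec (Fin k) D → Bool) → ℕ
  size A = ∑ʷ D (𝟙 ∘ A)

  size-not : ∀ A → size A + size (not ∘ A) ≡ k ^ D
  size-not A = begin
    size A + size (not ∘ A)                                   ≡⟨ ∑-distrib-+ (𝟙 ∘ A ∘ word D) (𝟙 ∘ not ∘ A ∘ word D) ⟨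
    ∑[ i < k ^ D ] (𝟙 (A (word D i)) + 𝟙 (not (A (word D i)))) ≡⟨ (sum-cong-≗ λ i → 𝟙-not (A (word D i))) ⟩
    ∑[ i < k ^ D ] 1                                          ≡⟨ ∑-const (k ^ D) 1 ⟩
    k ^ D * 1                                                 ≡⟨ *-identityʳ (k ^ D) ⟩
    k ^ D                                                     ∎
    where open ≡-Reasoning

  module _ (R : ℕ) (A B : Vec (Fin k) D → Bool)
           (apart : ∀ x y → A x ≡ true → B y ≡ true → R ≤ hamming x y) where

    private
      term : Vec (Fin k) D → Vec (Fin k) D → ℕ
      term x w = if A w then R ∸ hamming w x else 0

      -- max(0, R − d(x, A)), as a supremum so that it makes sense for empty A.
      closeness : Vec (Fin k) D → ℕ
      closeness x = ⨆ λ i → term x (word D i)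

      closeness-A : ∀ x → A x ≡ true → R ≤ closeness x
      closeness-A x x∈A = ≤-trans (≤-reflexive (sym term≡R)) (⨆-upper (λ i → term x (word D i)) (index x))
        where
        term≡R : term x (word D (index x)) ≡ R
        term≡R rewrite word-index x | x∈A | hamming-refl x = refl

      closeness-B : ∀ x → B x ≡ true → closeness x ≡ 0
      closeness-B x x∈B = n≤0⇒n≡0 (⨆-least λ i → vanish (word D i))
        where
        vanish : ∀ w → term x w ≤ 0
        vanish w with A w in w∈A
        ... | true  = ≤-reflexive (m≤n⇒m∸n≡0 (apart w x w∈A x∈B))
        ... | false = z≤n

      -- For each fixed `w` the triangle inequality bounds the change of `R ∸ hamming w x` by one,
      -- and a supremum inherits this.
      closeness-lipschitz : ∀ x y → hamming x y ≤ 1 → closeness x ≤ suc (closeness y)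
      closeness-lipschitz x y d≤1 = ⨆-least λ i →
        ≤-trans (step (word D i)) (s≤s (⨆-upper (λ i → term y (word D i)) i))
        where
        step : ∀ w → term x w ≤ suc (term y w)
        step w with A w
        ... | false = z≤n
        ... | true  = begin
          R ∸ hamming w x              ≤⟨ m≤n+m∸n (R ∸ hamming w x) 1 ⟩
          suc (R ∸ hamming w x ∸ 1)    ≡⟨ cong suc (∸-+-assoc R (hamming w x) 1) ⟩
          suc (R ∸ (hamming w x + 1))  ≤⟨ s≤s (∸-monoʳ-≤ R triangle) ⟩
          suc (R ∸ hamming w y)        ∎
          where
          open ≤-Reasoning
          triangle : hamming w y ≤ hamming w x + 1
          triangle = ≤-trans (hamming-triangle w x y) (+-monoʳ-≤ (hamming w x) d≤1)

      ∣m-n∣≤1 : ∀ {m n} → m ≤ suc n → n ≤ suc m → ∣ m - n ∣ ≤ 1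
      ∣m-n∣≤1 {zero}  {n}     _         n≤1       = n≤1
      ∣m-n∣≤1 {suc m} {zero}  m≤1       _         = m≤1
      ∣m-n∣≤1 {suc m} {suc n} (s≤s m≤n) (s≤s n≤m) = ∣m-n∣≤1 m≤n n≤m

      sq-closeness≤1 : ∀ x y → hamming x y ≤ 1 → sq (closeness x) (closeness y) ≤ 1
      sq-closeness≤1 x y d≤1 = *-mono-≤ close close
        where close = ∣m-n∣≤1 (closeness-lipschitz x y d≤1)
                              (closeness-lipschitz y x (subst (_≤ 1) (hamming-sym x y) d≤1))

      outside-B : Vec (Fin k) D → ℕ
      outside-B = 𝟙 ∘ not ∘ B

      -- With both words in `B` the left side is zero; otherwise one of the indicators is 1 and the
      -- Lipschitz bound suffices. Thus only pairs meeting the complement of `B` contribute to the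
      -- energy.
      local : ∀ x y → hamming x y ≤ 1 → sq (closeness x) (closeness y) ≤ outside-B x + outside-B y
      local x y d≤1 with B x in x∈B | B y in y∈B
      ... | true  | true  rewrite closeness-B x x∈B | closeness-B y y∈B = z≤n
      ... | true  | false = sq-closeness≤1 x y d≤1
      ... | false | _     = ≤-trans (sq-closeness≤1 x y d≤1) (m≤m+n 1 _)

      spread : ∀ x y → R * R * (𝟙 (A x) * 𝟙 (B y)) ≤ sq (closeness x) (closeness y)
      spread x y with A x in x∈A | B y in y∈B
      ... | false | _     = ≤-trans (≤-reflexive (*-zeroʳ (R * R))) z≤n
      ... | true  | false = ≤-trans (≤-reflexive (*-zeroʳ (R * R))) z≤n
      ... | true  | true  rewrite closeness-B y y∈B | ∣-∣-identityʳ (closeness x) | *-identityʳ (R * R) =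
        *-mono-≤ (closeness-A x x∈A) (closeness-A x x∈A)

      product : R * R * (size A * size B) ≤ ∑ʷ D (λ x → ∑ʷ D λ y → sq (closeness x) (closeness y))
      product = begin
        R * R * (size A * size B)
          ≡⟨ cong (R * R *_) (*-distribʳ-sum (size B) (𝟙 ∘ A ∘ word D)) ⟩
        R * R * (∑[ i < k ^ D ] (𝟙 (A (word D i)) * size B))
          ≡⟨ *-distribˡ-sum (R * R) (λ i → 𝟙 (A (word D i)) * size B) ⟩
        ∑[ i < k ^ D ] (R * R * (𝟙 (A (word D i)) * size B))
          ≡⟨ (sum-cong-≗ λ i → trans (cong (R * R *_) (*-distribˡ-sum (𝟙 (A (word D i))) (𝟙 ∘ B ∘ word D)))
               (*-distribˡ-sum (R * R) (λ j → 𝟙 (A (word D i)) * 𝟙 (B (word D j))))) ⟩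
        ∑[ i < k ^ D ] ∑[ j < k ^ D ] (R * R * (𝟙 (A (word D i)) * 𝟙 (B (word D j))))
          ≤⟨ (∑-mono λ i → ∑-mono λ j → spread (word D i) (word D j)) ⟩
        ∑ʷ D (λ x → ∑ʷ D λ y → sq (closeness x) (closeness y)) ∎
        where open ≤-Reasoning

    -- `closeness` is at least `R` on `A` and zero on `B`, which bounds its pair sum from below;
    -- `local` bounds its energy from above, and Efron-Stein compares the two. The asymmetry is
    -- deliberate: for large `B` the right side is small.
    isoperimetry : R * R * (size A * size B) ≤ k ^ D * (2 * D * size (not ∘ B))
    isoperimetry = *-cancelˡ-≤ k (begin
      k * (R * R * (size A * size B))
        ≤⟨ *-monoʳ-≤ k product ⟩
      k * ∑ʷ D (λ x → ∑ʷ D λ y → sq (closeness x) (closeness y))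
        ≤⟨ efron-stein D closeness ⟩
      k ^ D * energy D closeness
        ≤⟨ *-monoʳ-≤ (k ^ D) (energy-≤ D closeness outside-B local) ⟩
      k ^ D * (D * (2 * k * size (not ∘ B)))
        ≡⟨ rearrange k (k ^ D) D (size (not ∘ B)) ⟩
      k * (k ^ D * (2 * D * size (not ∘ B))) ∎)
      where
      open ≤-Reasoning
      rearrange : ∀ k n D c → n * (D * (2 * k * c)) ≡ k * (n * (2 * D * c))
      rearrange = solve-∀

-- Counting in subsets

∣-∣-∑ : ∀ {n} (p : Subset n) → ∣ p ∣ ≡ ∑[ x < n ] 𝟙 (lookup p x)
∣-∣-∑ []          = refl
∣-∣-∑ (true ∷ p)  = cong suc (∣-∣-∑ p)
∣-∣-∑ (false ∷ p) = ∣-∣-∑ p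

module _ {n p} {P : Fin n → Set p} where

  ⟪_⟫ : (∀ x → Dec (P x)) → Subset n
  ⟪ P? ⟫ = tabulate (does ∘ P?)

  module _ (P? : ∀ x → Dec (P x)) where

    ∈⟪⟫⁺ : ∀ {x} → P x → x ∈ ⟪ P? ⟫
    ∈⟪⟫⁺ {x} px = lookup⇒[]= x ⟪ P? ⟫
      (trans (lookup∘tabulate (does ∘ P?) x) (dec-true (P? x) px))

    ∈⟪⟫⁻ : ∀ {x} → x ∈ ⟪ P? ⟫ → P x
    ∈⟪⟫⁻ {x} x∈ with P? x | trans (sym (lookup∘tabulate (does ∘ P?) x)) ([]=⇒lookup x∈)
    ... | yes px | _ = px

    ∣⟪⟫∣ : ∣ ⟪ P? ⟫ ∣ ≡ ∑[ x < n ] 𝟙 (does (P? x))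
    ∣⟪⟫∣ = trans (∣-∣-∑ ⟪ P? ⟫) (sum-cong-≗ λ x → cong 𝟙 (lookup∘tabulate (does ∘ P?) x))

∑-𝟙-≟ : ∀ {n} (f : Fin n → ℕ) i → ∑[ j < n ] (𝟙 (does (i Fin.≟ j)) * f j) ≡ f i
∑-𝟙-≟ {suc n} f zero    = begin
  f zero + 0 + ∑[ j < n ] 0 ≡⟨ cong₂ _+_ (+-identityʳ (f zero)) (sum-replicate-zero n) ⟩
  f zero + 0                ≡⟨ +-identityʳ (f zero) ⟩
  f zero                    ∎
  where open ≡-Reasoning
∑-𝟙-≟ {suc n} f (suc i) = ∑-𝟙-≟ (f ∘ suc) i

-- Each `x` is counted at the single value `a = f x`.
∑-fibres : ∀ {n c} (f : Fin n → Fin c) (g : Fin n → ℕ) →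
           sum g ≡ ∑[ a < c ] ∑[ x < n ] (𝟙 (does (f x Fin.≟ a)) * g x)
∑-fibres {n} {c} f g = begin
  sum g                                                    ≡⟨ (sum-cong-≗ λ x → ∑-𝟙-≟ (λ _ → g x) (f x)) ⟨
  ∑[ x < n ] ∑[ a < c ] (𝟙 (does (f x Fin.≟ a)) * g x)     ≡⟨ ∑-comm (λ x a → 𝟙 (does (f x Fin.≟ a)) * g x) ⟩
  ∑[ a < c ] ∑[ x < n ] (𝟙 (does (f x Fin.≟ a)) * g x)     ∎
  where open ≡-Reasoning

∣p∣≤1 : ∀ {n} (p : Subset n) → (∀ {x y} → x ∈ p → y ∈ p → x ≡ y) → ∣ p ∣ ≤ 1
∣p∣≤1 {n} p unique with nonempty? p
... | yes (x , x∈p) = ≤-trans (p⊆q⇒∣p∣≤∣q∣ p⊆⁅x⁆) (≤-reflexive (∣⁅x⁆∣≡1 x))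
  where
  p⊆⁅x⁆ : p ⊆ ⁅ x ⁆
  p⊆⁅x⁆ y∈p = subst (_∈ ⁅ x ⁆) (unique x∈p y∈p) (x∈⁅x⁆ x)
... | no empty      = ≤-trans (≤-reflexive (trans (cong ∣_∣ (Empty-unique empty)) (∣⊥∣≡0 n))) z≤n

-- If no part exceeds the average `n / m`, the sum is at most `n`. Otherwise a part `c` above
-- average leaves `s = n - f c`, and each other part is at most `s / m`, so together they fit into
-- `s`.
∑-≤-balanced : ∀ {m} .{{_ : NonZero m}} n (f : Fin m → ℕ) →
  (∀ c → n < m * f c → ∃[ s ] f c + s ≡ n × (∀ c′ → c ≢ c′ → m * f c′ ≤ s)) →
  sum f ≤ n
∑-≤-balanced {m} n f large with any? (λ c → n <? m * f c)
... | no none = *-cancelˡ-≤ m (begin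
  m * sum f                    ≡⟨ *-distribˡ-sum m f ⟩
  ∑[ c < m ] (m * f c)         ≤⟨ ∑-mono (λ c → ≮⇒≥ λ n< → none (c , n<)) ⟩
  ∑[ c < m ] n                 ≡⟨ ∑-const m n ⟩
  m * n                        ∎)
  where open ≤-Reasoning
... | yes (c , n<) with s , f+s≡n , rest ← large c n< = *-cancelˡ-≤ m (begin
  m * sum f                                            ≡⟨ *-distribˡ-sum m f ⟩
  ∑[ c′ < m ] (m * f c′)                               ≤⟨ ∑-mono bound ⟩
  -- The term `s` is granted to `c` itself as well; even with this slack the total is exactly
  -- `m * (f c + s)`.
  ∑[ c′ < m ] (𝟙 (does (c Fin.≟ c′)) * (m * f c′) + s)
    ≡⟨ ∑-distrib-+ (λ c′ → 𝟙 (does (c Fin.≟ c′)) * (m * f c′)) (λ _ → s) ⟩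
  ∑[ c′ < m ] (𝟙 (does (c Fin.≟ c′)) * (m * f c′)) + ∑[ c′ < m ] s
    ≡⟨ cong₂ _+_ (∑-𝟙-≟ (λ c′ → m * f c′) c) (∑-const m s) ⟩
  m * f c + m * s                                      ≡⟨ *-distribˡ-+ m (f c) s ⟨
  m * (f c + s)                                        ≡⟨ cong (m *_) f+s≡n ⟩
  m * n                                                ∎)
  where
  open ≤-Reasoning
  bound : ∀ c′ → m * f c′ ≤ 𝟙 (does (c Fin.≟ c′)) * (m * f c′) + s
  bound c′ with c Fin.≟ c′
  ... | yes _   = ≤-trans (≤-reflexive (sym (*-identityˡ _))) (m≤m+n _ s)
  ... | no c≢c′ = rest c′ c≢c′

-- Numbering of words and first differences.

index-word : ∀ {k} D (i : Fin (k ^ D)) → index (word D i) ≡ i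
index-word     zero    zero = refl
index-word {k} (suc D) i    =
  trans (cong (combine (proj₁ (remQuot {k} (k ^ D) i))) (index-word D (proj₂ (remQuot {k} (k ^ D) i))))
        (combine-remQuot {k} (k ^ D) i)

firstDifference : ∀ {k d} (u v : Vec (Fin k) d) → u ≢ v →
  ∃[ i ] (∀ j → j Fin.< i → lookup u j ≡ lookup v j) × lookup u i ≢ lookup v i
firstDifference []      []      u≢v = contradiction refl u≢v
firstDifference (s ∷ u) (t ∷ v) u≢v with s Fin.≟ t
... | no s≢t   = zero , (λ _ ()) , s≢t
... | yes refl with i , before , differ ← firstDifference u v (u≢v ∘ cong (s ∷_)) =
  suc i , (λ { zero _ → refl ; (suc j) (s≤s j<i) → before j j<i }) , differ

-- Reflections of words

module _ {k : ℕ} .{{_ : NonZero k}} where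

  -- This is `a − s` modulo `k`, with `k ∸ toℕ s` standing for `− s`.
  reflect : Fin k → Fin k → Fin k
  reflect a s = fromℕ< (m%n<n (toℕ a + (k ∸ toℕ s)) k)

  private
    toℕ-reflect : ∀ a s → toℕ (reflect a s) ≡ (toℕ a + (k ∸ toℕ s)) % k
    toℕ-reflect a s = toℕ-fromℕ< (m%n<n (toℕ a + (k ∸ toℕ s)) k)

    toℕ-% : ∀ (a : Fin k) → toℕ a % k ≡ toℕ a
    toℕ-% a = m<n⇒m%n≡m (toℕ<n a)

    %-congˡ-+ : ∀ {x y} z → x % k ≡ y % k → (x + z) % k ≡ (y + z) % k
    %-congˡ-+ {x} {y} z x≡y = begin
      (x + z) % k           ≡⟨ %-distribˡ-+ x z k ⟩
      (x % k + z % k) % k   ≡⟨ cong (λ w → (w + z % k) % k) x≡y ⟩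
      (y % k + z % k) % k   ≡⟨ %-distribˡ-+ y z k ⟨
      (y + z) % k           ∎
      where open ≡-Reasoning

    -- Adding `pred k * z` completes `z` to `k * z`, which vanishes modulo `k`.
    %-cancelʳ-+ : ∀ {x y} z → (x + z) % k ≡ (y + z) % k → x % k ≡ y % k
    %-cancelʳ-+ {x} {y} z eq = begin
      x % k                      ≡⟨ reduce x ⟨
      (x + z + pred k * z) % k   ≡⟨ %-congˡ-+ (pred k * z) eq ⟩
      (y + z + pred k * z) % k   ≡⟨ reduce y ⟩
      y % k                      ∎
      where
      open ≡-Reasoning
      reduce : ∀ x → (x + z + pred k * z) % k ≡ x % k
      reduce x = begin
        (x + z + pred k * z) % k       ≡⟨ cong (_% k) (+-assoc x z _) ⟩
        (x + suc (pred k) * z) % k     ≡⟨ cong (λ w → (x + w * z) % k) (suc-pred k) ⟩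
        (x + k * z) % k                ≡⟨ cong (λ w → (x + w) % k) (*-comm k z) ⟩
        (x + z * k) % k                ≡⟨ [m+kn]%n≡m%n x z k ⟩
        x % k                          ∎

  -- The defining equation `(a − s) + s = a`; involutivity and injectivity in either argument are
  -- drawn from it.
  reflect-+ : ∀ a s → (toℕ (reflect a s) + toℕ s) % k ≡ toℕ a
  reflect-+ a s = begin
    (toℕ (reflect a s) + toℕ s) % k              ≡⟨ cong (λ w → (w + toℕ s) % k) (toℕ-reflect a s) ⟩
    ((toℕ a + (k ∸ toℕ s)) % k + toℕ s) % k      ≡⟨ %-congˡ-+ (toℕ s) (m%n%n≡m%n (toℕ a + (k ∸ toℕ s)) k) ⟩
    (toℕ a + (k ∸ toℕ s) + toℕ s) % k
      ≡⟨ cong (_% k) (trans (+-assoc (toℕ a) _ _) (cong (toℕ a +_) (m∸n+n≡m (<⇒≤ (toℕ<n s))))) ⟩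
    (toℕ a + k) % k                              ≡⟨ [m+n]%n≡m%n (toℕ a) k ⟩
    toℕ a % k                                    ≡⟨ toℕ-% a ⟩
    toℕ a                                        ∎
    where open ≡-Reasoning

  reflect-involutive : ∀ a s → reflect a (reflect a s) ≡ s
  reflect-involutive a s = toℕ-injective (begin
    toℕ (reflect a u)      ≡⟨ toℕ-% (reflect a u) ⟨
    toℕ (reflect a u) % k
      ≡⟨ %-cancelʳ-+ (toℕ u) (trans (reflect-+ a u)
           (trans (sym (reflect-+ a s)) (cong (_% k) (+-comm (toℕ u) (toℕ s))))) ⟩
    toℕ s % k              ≡⟨ toℕ-% s ⟩
    toℕ s                  ∎)
    where
    open ≡-Reasoning
    u = reflect a s

  reflect-injectiveˡ : ∀ {a b} s → reflect a s ≡ reflect b s → a ≡ b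
  reflect-injectiveˡ {a} {b} s eq = toℕ-injective
    (trans (sym (reflect-+ a s)) (trans (cong (λ u → (toℕ u + toℕ s) % k) eq) (reflect-+ b s)))

  reflect-injectiveʳ : ∀ {a s t} → reflect a s ≡ reflect a t → s ≡ t
  reflect-injectiveʳ {a} {s} {t} eq =
    trans (sym (reflect-involutive a s)) (trans (cong (reflect a) eq) (reflect-involutive a t))

  -- Both sides are `a − a = b − b = 0`. This is what makes the constant words below coincide after
  -- reflection.
  reflect-diagonal : ∀ a b → reflect a a ≡ reflect b b
  reflect-diagonal a b = toℕ-injective (trans (toℕ-diagonal a) (sym (toℕ-diagonal b)))
    where
    toℕ-diagonal : ∀ a → toℕ (reflect a a) ≡ k % k
    toℕ-diagonal a = trans (toℕ-reflect a a) (cong (_% k) (m+[n∸m]≡n (<⇒≤ (toℕ<n a))))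

  twist : ∀ {D} → Fin k → Vec (Fin k) D → Vec (Fin k) D
  twist a = Vec.map (reflect a)

  twist-involutive : ∀ {D} a (x : Vec (Fin k) D) → twist a (twist a x) ≡ x
  twist-involutive a []      = refl
  twist-involutive a (s ∷ x) = cong₂ _∷_ (reflect-involutive a s) (twist-involutive a x)

  ∑ʷ-twist : ∀ D a (f : Vec (Fin k) D → ℕ) → ∑ʷ D (f ∘ twist a) ≡ ∑ʷ D f
  ∑ʷ-twist D a = ∑ʷ-map (Perm.permutation (reflect a) (reflect a) (reflect-involutive a) (reflect-involutive a)) D

  -- Reflections are injective, so differing letters stay different.
  hamming≤hamming-twist : ∀ {D} a (x y : Vec (Fin k) D) → hamming x y ≤ hamming (twist a x) (twist a y)
  hamming≤hamming-twist a []      []      = z≤n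
  hamming≤hamming-twist a (s ∷ x) (t ∷ y) = +-mono-≤ letter (hamming≤hamming-twist a x y)
    where
    letter : mismatch s t ≤ mismatch (reflect a s) (reflect a t)
    letter with s Fin.≟ t
    ... | yes _   = z≤n
    ... | no s≢t = ≤-reflexive (sym (mismatch-≢ (s≢t ∘ reflect-injectiveʳ)))

  -- In every coordinate either the letters differ, or they are equal and their reflections in `a`
  -- and `b` differ. So two words cannot be close both before and after reflection in distinct
  -- values.
  hamming-twists : ∀ {D a b} → a ≢ b → ∀ (x y : Vec (Fin k) D) →
                   D ≤ hamming x y + hamming (twist a x) (twist b y)
  hamming-twists         a≢b []      []      = z≤n
  hamming-twists {suc D} {a} {b} a≢b (s ∷ x) (t ∷ y) = begin
    1 + D
      ≤⟨ +-mono-≤ letter (hamming-twists a≢b x y) ⟩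
    (mismatch s t + mismatch (reflect a s) (reflect b t)) + (hamming x y + hamming (twist a x) (twist b y))
      ≡⟨ interchange (mismatch s t) _ _ _ ⟩
    (mismatch s t + hamming x y) + (mismatch (reflect a s) (reflect b t) + hamming (twist a x) (twist b y)) ∎
    where
    open ≤-Reasoning
    letter : 1 ≤ mismatch s t + mismatch (reflect a s) (reflect b t)
    letter with s Fin.≟ t
    ... | yes refl = ≤-reflexive (sym (mismatch-≢ (a≢b ∘ reflect-injectiveˡ s)))
    ... | no _     = s≤s z≤n

-- The graph

gap : ∀ {k} → Fin k → Fin k → ℕ
gap a b = ∣ toℕ a - toℕ b ∣

gap-sym : ∀ {k} (a b : Fin k) → gap a b ≡ gap b a
gap-sym a b = ∣-∣-comm (toℕ a) (toℕ b)

gap≤ : ∀ {k} (a b : Fin k) → gap a b ≤ k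
gap≤ a b = ≤-trans (∣m-n∣≤m⊔n (toℕ a) (toℕ b)) (⊔-lub (<⇒≤ (toℕ<n a)) (<⇒≤ (toℕ<n b)))

gap≥1 : ∀ {k} {a b : Fin k} → a ≢ b → 1 ≤ gap a b
gap≥1 a≢b = n≢0⇒n>0 (a≢b ∘ toℕ-injective ∘ ∣m-n∣≡0⇒m≡n)

gap-+ : ∀ {k} {a b c : Fin k} → a Fin.< b → b Fin.< c → gap a b + gap b c ≡ gap a c
gap-+ {a = a} {b} {c} a<b b<c = add (<⇒≤ a<b) (<⇒≤ b<c)
  where
  add : ∀ {l m n} → l ≤ m → m ≤ n → ∣ l - m ∣ + ∣ m - n ∣ ≡ ∣ l - n ∣
  add {l} l≤m m≤n with o , refl ← m≤n⇒∃[o]m+o≡n l≤m with p , refl ← m≤n⇒∃[o]m+o≡n m≤n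
    rewrite ∣m-m+n∣≡n l o | ∣m-m+n∣≡n (l + o) p | +-assoc l o p = sym (∣m-m+n∣≡n l (o + p))

module Construction (k d D r : ℕ) .{{_ : NonZero k}} where

  N : ℕ
  N = k ^ D * k ^ d

  hue : Fin N → Fin (k ^ d)
  hue x = proj₂ (remQuot {k ^ D} (k ^ d) x)

  position : Fin N → Vec (Fin k) D
  position x = word D (proj₁ (remQuot {k ^ D} (k ^ d) x))

  level : Fin d → Fin N → Fin k
  level i x = lookup (word d (hue x)) i

  vertex : Vec (Fin k) D → Fin (k ^ d) → Fin N
  vertex w c = combine (index w) c

  hue-combine : ∀ (i : Fin (k ^ D)) c → hue (combine i c) ≡ c
  hue-combine i c = cong proj₂ (remQuot-combine i c)

  position-vertex : ∀ w c → position (vertex w c) ≡ w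
  position-vertex w c = trans (cong (word D ∘ proj₁) (remQuot-combine (index w) c)) (word-index w)

  level-vertex : ∀ i w c → level i (vertex w c) ≡ lookup (word d c) i
  level-vertex i w c = cong (λ c → lookup (word d c) i) (hue-combine (index w) c)

  twisted : Fin d → Fin N → Vec (Fin k) D
  twisted i x = twist (level i x) (position x)

  record Edge (i : Fin d) (x y : Fin N) : Set where
    constructor edge
    field
      before  : ∀ j → j Fin.< i → level j x ≡ level j y
      differ  : level i x ≢ level i y
      close   : hamming (twisted i x) (twisted i y) ≤ gap (level i x) (level i y) * r

  open Edge

  edge? : ∀ i x y → Dec (Edge i x y)
  edge? i x y with all? (λ j → (j Fin.<? i) →-dec (level j x Fin.≟ level j y))
                 | level i x Fin.≟ level i y
                 | hamming (twisted i x) (twisted i y) ≤? gap (level i x) (level i y) * r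
  ... | no ¬b | _      | _     = no (¬b ∘ before)
  ... | yes _ | yes eq | _     = no λ e → differ e eq
  ... | yes _ | no _   | no ¬c = no (¬c ∘ close)
  ... | yes b | no ne  | yes c = yes (edge b ne c)

  edge-sym : ∀ {i x y} → Edge i x y → Edge i y x
  edge-sym {i} {x} {y} (edge b ne c) = edge (λ j j<i → sym (b j j<i)) (ne ∘ sym)
    (subst₂ _≤_ (hamming-sym (twisted i x) (twisted i y)) (cong (_* r) (gap-sym (level i x) (level i y))) c)

  layer : Fin d → Graph N
  layer i = record
    { V          = ⊤
    ; Adj        = Edge i
    ; Adj?       = edge? i
    ; Adj⇒∈V     = λ _ → ∈⊤
    ; Adj-sym    = edge-sym
    ; Adj-irrefl = λ e → differ e refl
    }

  graph : Graph N
  graph = record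
    { V          = ⊤
    ; Adj        = λ x y → ∃[ i ] Edge i x y
    ; Adj?       = λ x y → any? λ i → edge? i x y
    ; Adj⇒∈V     = λ _ → ∈⊤
    ; Adj-sym    = λ (i , e) → i , edge-sym e
    ; Adj-irrefl = λ (i , e) → differ e refl
    }

  -- The argument supplies a layer in which every vertex lies; without layers the union would have
  -- no vertices.
  union : Fin d → IsUnion graph layer
  union i = (λ x → mk⇔ (λ _ → i , ∈⊤) (λ _ → ∈⊤)) , (λ x y → mk⇔ (λ e → e) (λ e → e))

  -- The distance allowed on an edge is proportional to the gap of the levels, and gaps add up along
  -- increasing levels, so it is compatible with the triangle inequality.
  edge-trans : ∀ {i x y z} → level i x Fin.< level i y → level i y Fin.< level i z →
               Edge i x y → Edge i y z → Edge i x z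
  edge-trans {i} {x} {y} {z} x<y y<z e f = edge
    (λ j j<i → trans (before e j j<i) (before f j j<i))
    (Fin.<⇒≢ (Fin.<-trans x<y y<z))
    (begin
      hamming (twisted i x) (twisted i z)
        ≤⟨ hamming-triangle (twisted i x) (twisted i y) (twisted i z) ⟩
      hamming (twisted i x) (twisted i y) + hamming (twisted i y) (twisted i z)
        ≤⟨ +-mono-≤ (close e) (close f) ⟩
      gap (level i x) (level i y) * r + gap (level i y) (level i z) * r
        ≡⟨ *-distribʳ-+ r (gap (level i x) (level i y)) _ ⟨
      (gap (level i x) (level i y) + gap (level i y) (level i z)) * r
        ≡⟨ cong (_* r) (gap-+ x<y y<z) ⟩
      gap (level i x) (level i z) * r ∎)
    where open ≤-Reasoning

  comparability : ∀ i → IsComparabilityGraph (layer i)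
  comparability i = _⪯_ , ⪯-isPartialOrder , adjacent⇔
    where
    _≺_ _⪯_ : Vertex (layer i) → Vertex (layer i) → Set
    (x , _) ≺ (y , _) = level i x Fin.< level i y × Edge i x y
    u ⪯ v = u ≡ v ⊎ u ≺ v

    ⪯-trans : ∀ {u v w} → u ⪯ v → v ⪯ w → u ⪯ w
    ⪯-trans (inj₁ refl)      v⪯w              = v⪯w
    ⪯-trans (inj₂ u≺v)       (inj₁ refl)      = inj₂ u≺v
    ⪯-trans (inj₂ (x<y , e)) (inj₂ (y<z , f)) = inj₂ (Fin.<-trans x<y y<z , edge-trans x<y y<z e f)

    ⪯-antisym : ∀ {u v} → u ⪯ v → v ⪯ u → u ≡ v
    ⪯-antisym (inj₁ u≡v)       _                = u≡v
    ⪯-antisym (inj₂ _)         (inj₁ v≡u)       = sym v≡u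
    ⪯-antisym (inj₂ (x<y , _)) (inj₂ (y<x , _)) = contradiction y<x (Fin.<-asym x<y)

    ⪯-isPartialOrder : IsPartialOrder _≡_ _⪯_
    ⪯-isPartialOrder = record
      { isPreorder = record { isEquivalence = isEquivalence ; reflexive = inj₁ ; trans = ⪯-trans }
      ; antisym    = ⪯-antisym
      }

    adjacent⇔ : ∀ u v → u ≢ v → _
    adjacent⇔ u@(x , _) v@(y , _) u≢v = mk⇔ orient forget
      where
      orient : Edge i x y → u ⪯ v ⊎ v ⪯ u
      orient e with Fin.<-cmp (level i x) (level i y)
      ... | tri< x<y _ _ = inj₁ (inj₂ (x<y , e))
      ... | tri≈ _ x≡y _ = contradiction x≡y (differ e)
      ... | tri> _ _ y<x = inj₂ (inj₂ (y<x , edge-sym e))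
      forget : u ⪯ v ⊎ v ⪯ u → Edge i x y
      forget (inj₁ (inj₁ u≡v))     = contradiction u≡v u≢v
      forget (inj₁ (inj₂ (_ , e))) = e
      forget (inj₂ (inj₁ v≡u))     = contradiction (sym v≡u) u≢v
      forget (inj₂ (inj₂ (_ , e))) = edge-sym e

  hue-proper : ∀ {x y} → Graph.Adj graph x y → hue x ≢ hue y
  hue-proper (i , e) eq = differ e (cong (λ c → lookup (word d c) i) eq)

  -- The clique number.

  module _ (far : 3 * k * r < D) where

    private
      close≤kr : ∀ {i x y} → Edge i x y → hamming (twisted i x) (twisted i y) ≤ k * r
      close≤kr {i} {x} {y} e = ≤-trans (close e) (*-monoˡ-≤ r (gap≤ (level i x) (level i y)))

      -- Two edges of layer i leaving y towards the same level force positions close to each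
      -- other, whereas an edge of another layer moves almost every coordinate.
      no-mixed-triangle : ∀ {i j x y z} → i Fin.< j → Edge i x y → Edge j x z → ¬ Graph.Adj graph y z
      no-mixed-triangle {i} {j} {x} {y} {z} i<j e f (l , g) with Fin.<-cmp l i
      -- Below `i` both `y` and `z` agree with `x`, so they cannot first differ there. If they first
      -- differ beyond `i`, then `y` and `x` both agree with `z` at `i`, contradicting `e`.
      ... | tri< l<i _ _ = differ g (trans (sym (before e l l<i)) (before f l (Fin.<-trans l<i i<j)))
      ... | tri> _ _ i<l = differ e (trans (before f i i<j) (sym (before g i i<l)))
      ... | tri≈ _ refl _ = <⇒≱ far (begin
        D
          ≤⟨ hamming-twists (differ f) (position x) (position z) ⟩
        hamming (position x) (position z) + hamming (twisted j x) (twisted j z)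
          ≤⟨ +-mono-≤ position-close (close≤kr f) ⟩
        (k * r + k * r) + k * r
          ≡⟨ triple k r ⟩
        3 * k * r ∎)
        where
        open ≤-Reasoning
        triple : ∀ k r → (k * r + k * r) + k * r ≡ 3 * k * r
        triple = solve-∀
        -- The edge of layer `j > i` keeps level `i`, so `x` and `z` are reflected in the same value
        -- there, and the reflection can be undone.
        position-close : hamming (position x) (position z) ≤ k * r + k * r
        position-close = begin
          hamming (position x) (position z)
            ≤⟨ hamming≤hamming-twist (level i x) (position x) (position z) ⟩
          hamming (twisted i x) (twist (level i x) (position z))
            ≡⟨ cong (λ a → hamming (twisted i x) (twist a (position z))) (before f i i<j) ⟩
          hamming (twisted i x) (twisted i z)
            ≤⟨ hamming-triangle (twisted i x) (twisted i y) (twisted i z) ⟩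
          hamming (twisted i x) (twisted i y) + hamming (twisted i y) (twisted i z)
            ≤⟨ +-mono-≤ (close≤kr e) (close≤kr g) ⟩
          k * r + k * r ∎

      triangle-layer : ∀ {i j x y z} → Edge i x y → Edge j x z → Graph.Adj graph y z → i ≡ j
      triangle-layer {i} {j} e f a with Fin.<-cmp i j
      ... | tri< i<j _ _ = contradiction a (no-mixed-triangle i<j e f)
      ... | tri≈ _ i≡j _ = i≡j
      ... | tri> _ _ j<i = contradiction (Graph.Adj-sym graph a) (no-mixed-triangle j<i f e)

    -- All edges of a clique belong to one layer i, so that level i is injective on it.
    ∣clique∣≤ : ∀ K → Clique graph K → ∣ K ∣ ≤ k
    ∣clique∣≤ K (_ , adjacent) with any? (λ x → any? λ y → (x ∈? K) ×-dec ((y ∈? K) ×-dec ¬? (x Fin.≟ y)))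
    ... | no ¬two = ≤-trans (∣p∣≤1 K (λ {x} {y} → unique x y)) (>-nonZero⁻¹ k)
      where
      unique : ∀ x y → x ∈ K → y ∈ K → x ≡ y
      unique x y x∈K y∈K with x Fin.≟ y
      ... | yes x≡y = x≡y
      ... | no x≢y  = contradiction (x , y , x∈K , y∈K , x≢y) ¬two
    ... | yes (x , y , x∈K , y∈K , x≢y) with i , e ← adjacent x y x∈K y∈K x≢y = begin
      ∣ K ∣                                                              ≡⟨ ∣-∣-∑ K ⟩
      ∑[ z < N ] 𝟙 (lookup K z)                                          ≡⟨ ∑-fibres (level i) (𝟙 ∘ lookup K) ⟩
      ∑[ a < k ] ∑[ z < N ] (𝟙 (does (level i z Fin.≟ a)) * 𝟙 (lookup K z)) ≤⟨ ∑-mono fibre≤1 ⟩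
      ∑[ a < k ] 1                                                       ≡⟨ ∑-const k 1 ⟩
      k * 1                                                              ≡⟨ *-identityʳ k ⟩
      k                                                                  ∎
      where
      open ≤-Reasoning

      -- The triangle `x y z` puts every edge at `x` into the layer of `x y`.
      star : ∀ z → z ∈ K → x ≢ z → Edge i x z
      star z z∈K x≢z with y Fin.≟ z
      ... | yes refl = e
      ... | no y≢z with j , f ← adjacent x z x∈K z∈K x≢z
                   with refl ← triangle-layer e f (adjacent y z y∈K z∈K y≢z) = f

      -- An edge avoiding `x` forms a triangle with two edges at `x`, which `star` has already
      -- placed in layer `i`.
      pure : ∀ u v → u ∈ K → v ∈ K → u ≢ v → Edge i u v
      pure u v u∈K v∈K u≢v with x Fin.≟ u
      ... | yes refl = star v v∈K u≢v
      ... | no x≢u with x Fin.≟ v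
      ... | yes refl = edge-sym (star u u∈K x≢u)
      ... | no x≢v with j , g ← adjacent u v u∈K v∈K u≢v
                   with refl ← triangle-layer (edge-sym (star u u∈K x≢u)) g (_ , star v v∈K x≢v) = g

      level-injective : ∀ {u v} → u ∈ K → v ∈ K → level i u ≡ level i v → u ≡ v
      level-injective {u} {v} u∈K v∈K eq with u Fin.≟ v
      ... | yes u≡v = u≡v
      ... | no u≢v  = contradiction eq (differ (pure u v u∈K v∈K u≢v))

      fibre≤1 : ∀ a → ∑[ z < N ] (𝟙 (does (level i z Fin.≟ a)) * 𝟙 (lookup K z)) ≤ 1
      fibre≤1 a = ≤-trans (≤-reflexive (trans (sum-cong-≗ rewrite-term) (sym (∣⟪⟫∣ fibre?))))
        (∣p∣≤1 ⟪ fibre? ⟫ λ {u} {v} u∈ v∈ →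
          let u≡a , u∈K = ∈⟪⟫⁻ fibre? u∈
              v≡a , v∈K = ∈⟪⟫⁻ fibre? v∈
          in level-injective u∈K v∈K (trans u≡a (sym v≡a)))
        where
        fibre? : ∀ z → Dec (level i z ≡ a × z ∈ K)
        fibre? z = (level i z Fin.≟ a) ×-dec (z ∈? K)
        does-∈? : ∀ z → lookup K z ≡ does (z ∈? K)
        does-∈? z with lookup K z in eq
        ... | true  = sym (dec-true (z ∈? K) (lookup⇒[]= z K eq))
        ... | false = sym (dec-false (z ∈? K) λ z∈K → case trans (sym eq) ([]=⇒lookup z∈K) of λ ())
        rewrite-term : ∀ z → 𝟙 (does (level i z Fin.≟ a)) * 𝟙 (lookup K z) ≡ 𝟙 (does (fibre? z))
        rewrite-term z rewrite does-∈? z with does (level i z Fin.≟ a) | does (z ∈? K)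
        ... | true  | true  = refl
        ... | true  | false = refl
        ... | false | _     = refl

  module _ (far : 3 * k * r < D) (o : Fin d) (o-least : ∀ (j : Fin d) → ¬ j Fin.< o) where

    private
      -- The word `a…a` with colour `(a,…,a)`. Its reflection in `a` is the zero word for every `a`,
      -- so two such vertices are at twisted distance zero; they already differ in the first
      -- coordinate `o`, where `before` holds vacuously.
      constant : Fin k → Fin N
      constant a = vertex (replicate D a) (index (replicate d a))

      level-constant : ∀ i a → level i (constant a) ≡ a
      level-constant i a = trans (level-vertex i (replicate D a) (index (replicate d a)))
        (trans (cong (λ w → lookup w i) (word-index (replicate d a))) (lookup-replicate i a))

      twisted-constant : ∀ i a → twisted i (constant a) ≡ replicate D (reflect a a)
      twisted-constant i a = trans
        (cong₂ twist (level-constant i a) (position-vertex (replicate D a) (index (replicate d a))))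
        (map-replicate (reflect a) a D)

      constant-edge : ∀ {a b} → a ≢ b → Edge o (constant a) (constant b)
      constant-edge {a} {b} a≢b = edge
        (λ j j<o → contradiction j<o (o-least j))
        (λ eq → a≢b (trans (sym (level-constant o a)) (trans eq (level-constant o b))))
        (≤-trans (≤-reflexive (trans (cong (hamming (twisted o (constant a))) (sym same))
                                     (hamming-refl (twisted o (constant a))))) z≤n)
        where
        same : twisted o (constant a) ≡ twisted o (constant b)
        same = trans (twisted-constant o a)
          (trans (cong (replicate D) (reflect-diagonal a b)) (sym (twisted-constant o b)))

      constant? : ∀ x → Dec (∃[ a ] constant a ≡ x)
      constant? x = any? λ a → constant a Fin.≟ x

      constants : Subset N
      constants = ⟪ constant? ⟫

      constants-clique : Clique graph constants
      constants-clique = (λ _ → ∈⊤) , λ x y x∈ y∈ x≢y → adjacent x y (∈⟪⟫⁻ constant? x∈) (∈⟪⟫⁻ constant? y∈) x≢y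
        where
        adjacent : ∀ x y → ∃[ a ] constant a ≡ x → ∃[ b ] constant b ≡ y → x ≢ y → Graph.Adj graph x y
        adjacent _ _ (a , refl) (b , refl) x≢y = o , constant-edge (x≢y ∘ cong constant)

      -- Level `o` takes the value `a` at `constant a`, so all `k` fibres are inhabited.
      ∣constants∣≥ : k ≤ ∣ constants ∣
      ∣constants∣≥ = begin
        k                    ≡⟨ *-identityʳ k ⟨
        k * 1                ≡⟨ ∑-const k 1 ⟨
        ∑[ a < k ] 1         ≤⟨ ∑-mono (λ a → ≤-trans (≤-reflexive (sym (at a))) (∑-term (term a) (constant a))) ⟩
        ∑[ a < k ] ∑[ x < N ] term a x ≡⟨ ∑-fibres (level o) (𝟙 ∘ does ∘ constant?) ⟨
        ∑[ x < N ] 𝟙 (does (constant? x)) ≡⟨ ∣⟪⟫∣ constant? ⟨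
        ∣ constants ∣        ∎
        where
        open ≤-Reasoning
        term : Fin k → Fin N → ℕ
        term a x = 𝟙 (does (level o x Fin.≟ a)) * 𝟙 (does (constant? x))
        at : ∀ a → term a (constant a) ≡ 1
        at a = cong₂ (λ b c → 𝟙 b * 𝟙 c)
          (dec-true (level o (constant a) Fin.≟ a) (level-constant o a))
          (dec-true (constant? (constant a)) (a , refl))

    cliqueNumber : IsCliqueNumber graph k
    cliqueNumber =
      (constants , constants-clique , ≤-antisym (∣clique∣≤ far constants constants-clique) ∣constants∣≥) ,
      λ { _ (K , K-clique , refl) → ∣clique∣≤ far K K-clique }

  -- The bound on independent sets.

  module _ .{{_ : NonZero D}} (r-large : k ^ d * k ^ d * (2 * D) ≤ r * r) where

    private instance
      nonZero-kᵈ : NonZero (k ^ d)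
      nonZero-kᵈ = m^n≢0 k d
      nonZero-kᴰ : NonZero (k ^ D)
      nonZero-kᴰ = m^n≢0 k D

    module _ (I : Subset N) (independent : Independent graph I) where

      private
        -- The words of `I` in colour `c`, after reflection in `a`: since reflection is an
        -- involution, `twist a w` is the position whose reflection is `w`.
        slice : Fin k → Fin (k ^ d) → Vec (Fin k) D → Bool
        slice a c w = lookup I (vertex (twist a w) c)

        part : Fin (k ^ d) → ℕ
        part c = ∑[ i < k ^ D ] 𝟙 (lookup I (combine i c))

        size-slice : ∀ a c → size (slice a c) ≡ part c
        size-slice a c = trans (∑ʷ-twist D a λ w → 𝟙 (lookup I (vertex w c)))
          (sum-cong-≗ λ i → cong (λ j → 𝟙 (lookup I (combine j c))) (index-word D i))

        part-complement : ∀ a c → part c + size (not ∘ slice a c) ≡ k ^ D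
        part-complement a c = trans (cong (_+ size (not ∘ slice a c)) (sym (size-slice a c))) (size-not (slice a c))

        module _ (c c′ : Fin (k ^ d)) (c≢c′ : c ≢ c′) where

          first : ∃[ i ] (∀ j → j Fin.< i → lookup (word d c) j ≡ lookup (word d c′) j) ×
                         lookup (word d c) i ≢ lookup (word d c′) i
          first = firstDifference (word d c) (word d c′) λ eq →
            c≢c′ (trans (sym (index-word d c)) (trans (cong index eq) (index-word d c′)))

          i = proj₁ first
          a  = lookup (word d c) i
          a′ = lookup (word d c′) i

          -- At the first coordinate where the colours differ the gap is at least 1, so reflected
          -- words closer than `r` would give an edge inside `I`.
          apart : ∀ x y → slice a′ c′ x ≡ true → slice a c y ≡ true → r ≤ hamming x y
          apart x y x∈ y∈ = ≮⇒≥ λ near → proj₂ independent u v (lookup⇒[]= u I y∈) (lookup⇒[]= v I x∈) (i , edge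
            (λ j j<i → trans (level-u j) (trans (proj₁ (proj₂ first) j j<i) (sym (level-v j))))
            (λ eq → proj₂ (proj₂ first) (trans (sym (level-u i)) (trans eq (level-v i))))
            (begin
              hamming (twisted i u) (twisted i v)  ≡⟨ cong₂ hamming (untwist y c) (untwist x c′) ⟩
              hamming y x                          ≡⟨ hamming-sym y x ⟩
              hamming x y                          ≤⟨ <⇒≤ near ⟩
              r                                    ≡⟨ *-identityˡ r ⟨
              1 * r                                ≤⟨ *-monoˡ-≤ r (gap≥1 (proj₂ (proj₂ first))) ⟩
              gap a a′ * r                         ≡⟨ cong₂ (λ s t → gap s t * r) (level-u i) (level-v i) ⟨
              gap (level i u) (level i v) * r      ∎))
            where
            open ≤-Reasoning
            u = vertex (twist a y) c
            v = vertex (twist a′ x) c′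
            level-u : ∀ j → level j u ≡ lookup (word d c) j
            level-u j = level-vertex j (twist a y) c
            level-v : ∀ j → level j v ≡ lookup (word d c′) j
            level-v j = level-vertex j (twist a′ x) c′
            untwist : ∀ w c → let b = lookup (word d c) i in twisted i (vertex (twist b w) c) ≡ w
            untwist w c = trans (cong₂ twist (level-vertex i (twist b w) c) (position-vertex (twist b w) c))
                                (twist-involutive b w)
              where b = lookup (word d c) i

          -- Colour `c` takes the place of `B`, so that the complement on the right is that of the
          -- class assumed large in `small`.
          cross : r * r * (part c′ * part c) ≤ k ^ D * (2 * D * size (not ∘ slice a c))
          cross = subst₂ (λ m n → r * r * (m * n) ≤ k ^ D * (2 * D * size (not ∘ slice a c)))
            (size-slice a′ c′) (size-slice a c) (isoperimetry r (slice a′ c′) (slice a c) apart)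

          -- One factor `k ^ d` absorbs the lower bound on `part c`, the other scales `part c′`;
          -- `r-large` converts both, together with `2 * D`, into the `r * r` of `cross`.
          small : k ^ D < k ^ d * part c → k ^ d * part c′ ≤ size (not ∘ slice a c)
          small big = *-cancelˡ-≤ (k ^ D) (begin
            n * (m * part c′)                ≤⟨ *-monoˡ-≤ (m * part c′) (<⇒≤ big) ⟩
            m * part c * (m * part c′)       ≤⟨ *-cancelˡ-≤ (2 * D) {{m*n≢0 2 D}} scaled ⟩
            n * size (not ∘ slice a c)       ∎)
            where
            open ≤-Reasoning
            m = k ^ d
            n = k ^ D
            scaled : 2 * D * (m * part c * (m * part c′)) ≤ 2 * D * (n * size (not ∘ slice a c))
            scaled = begin
              2 * D * (m * part c * (m * part c′))  ≡⟨ regroup D m (part c) (part c′) ⟩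
              m * m * (2 * D) * (part c′ * part c)  ≤⟨ *-monoˡ-≤ (part c′ * part c) r-large ⟩
              r * r * (part c′ * part c)            ≤⟨ cross ⟩
              n * (2 * D * size (not ∘ slice a c))  ≡⟨ swap n (2 * D) _ ⟩
              2 * D * (n * size (not ∘ slice a c))  ∎
              where
              regroup : ∀ D m x y → 2 * D * (m * x * (m * y)) ≡ m * m * (2 * D) * (y * x)
              regroup = solve-∀
              swap : ∀ a b c → a * (b * c) ≡ b * (a * c)
              swap = solve-∀

        part-large : ∀ c → k ^ D < k ^ d * part c →
          ∃[ s ] part c + s ≡ k ^ D × (∀ c′ → c ≢ c′ → k ^ d * part c′ ≤ s)
        part-large c big = k ^ D ∸ part c , m+[n∸m]≡n part≤ , λ c′ c≢c′ →
          ≤-trans (small c c′ c≢c′ big) (≤-reflexive (complement (a c c′ c≢c′)))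
          where
          -- The reflection value `a` varies with `c′`, but the size of the complement does not.
          complement : ∀ a → size (not ∘ slice a c) ≡ k ^ D ∸ part c
          complement a = trans (sym (m+n∸m≡n (part c) _)) (cong (_∸ part c) (part-complement a c))
          part≤ : part c ≤ k ^ D
          part≤ = begin
            part c             ≤⟨ ∑-mono (λ i → 𝟙≤1 (lookup I (combine {k ^ D} i c))) ⟩
            ∑[ i < k ^ D ] 1   ≡⟨ ∑-const (k ^ D) 1 ⟩
            k ^ D * 1          ≡⟨ *-identityʳ (k ^ D) ⟩
            k ^ D              ∎
            where
            open ≤-Reasoning
            𝟙≤1 : ∀ b → 𝟙 b ≤ 1
            𝟙≤1 true  = ≤-refl
            𝟙≤1 false = z≤n

      ∣independent∣≤ : ∣ I ∣ ≤ k ^ D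
      ∣independent∣≤ = begin
        ∣ I ∣                                                        ≡⟨ ∣-∣-∑ I ⟩
        ∑[ x < N ] 𝟙 (lookup I x)                                    ≡⟨ ∑-combine (k ^ D) (k ^ d) (𝟙 ∘ lookup I) ⟩
        ∑[ i < k ^ D ] ∑[ c < k ^ d ] 𝟙 (lookup I (combine i c))     ≡⟨ ∑-comm (λ i c → 𝟙 (lookup I (combine {k ^ D} i c))) ⟩
        ∑[ c < k ^ d ] part c                                        ≤⟨ ∑-≤-balanced (k ^ D) part part-large ⟩
        k ^ D                                                        ∎
        where open ≤-Reasoning

-- Fractional colourings

-- Kept general because list sums are taken both in `ℕ`, for multiplicities, and in `ℚ`, for the
-- terms of Cauchy sequences.
module ListSum {c ℓ} (M : CommutativeMonoid c ℓ) where

  open CommutativeMonoid M renaming (refl to ≈-refl; sym to ≈-sym; trans to ≈-trans)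
  open CommutativeMonoidSum M using () renaming (sum to ∑ꟳ; ∑-distrib-+ to ∑ꟳ-∙; sum-replicate-zero to ∑ꟳ-ε)

  ∑ᴸ : ∀ {a} {A : Set a} → (A → Carrier) → List A → Carrier
  ∑ᴸ f xs = foldr _∙_ ε (map f xs)

  module _ {a} {A : Set a} where

    ∑ᴸ-comm : ∀ {n} (f : A → Fin n → Carrier) xs → ∑ᴸ (λ x → ∑ꟳ (f x)) xs ≈ ∑ꟳ (λ i → ∑ᴸ (λ x → f x i) xs)
    ∑ᴸ-comm {n} f []       = ≈-sym (∑ꟳ-ε n)
    ∑ᴸ-comm     f (x ∷ xs) = ≈-trans (∙-congˡ (∑ᴸ-comm f xs)) (≈-sym (∑ꟳ-∙ (f x) _))

    ∑ᴸ-cong : ∀ {f g : A → Carrier} → (∀ x → f x ≈ g x) → ∀ xs → ∑ᴸ f xs ≈ ∑ᴸ g xs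
    ∑ᴸ-cong f≈g []       = ≈-refl
    ∑ᴸ-cong f≈g (x ∷ xs) = ∙-cong (f≈g x) (∑ᴸ-cong f≈g xs)

    ∑ᴸ-filter : ∀ {p} {P : Pred A p} (P? : Decidable P) (f : A → Carrier) xs →
                ∑ᴸ f (filter P? xs) ≈ ∑ᴸ (λ x → if does (P? x) then f x else ε) xs
    ∑ᴸ-filter P? f []       = ≈-refl
    ∑ᴸ-filter P? f (x ∷ xs) with does (P? x)
    ... | true  = ∙-congˡ (∑ᴸ-filter P? f xs)
    ... | false = ≈-trans (∑ᴸ-filter P? f xs) (≈-sym (identityˡ _))

    ∑ᴸ-++ : ∀ (f : A → Carrier) xs ys → ∑ᴸ f (xs ++ ys) ≈ ∑ᴸ f xs ∙ ∑ᴸ f ys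
    ∑ᴸ-++ f []       ys = ≈-sym (identityˡ _)
    ∑ᴸ-++ f (x ∷ xs) ys = ≈-trans (∙-congˡ (∑ᴸ-++ f xs ys)) (≈-sym (assoc _ _ _))

open ListSum +-0-commutativeMonoid
module ℚᴸ = ListSum ℚ.+-0-commutativeMonoid
module ℚꟳ = CommutativeMonoidSum ℚ.+-0-commutativeMonoid
open MonoidMult ℚ.+-0-monoid using () renaming (_×_ to _·_; ×-assocˡ to ·-assocˡ)

-- Multiplicities of subsets in lists.

_≟ˢ_ : ∀ {n} (I J : Subset n) → Dec (I ≡ J)
_≟ˢ_ = ≡-dec Bool._≟_

multiplicity : ∀ {n} → Subset n → List (Subset n) → ℕ
multiplicity J = ∑ᴸ λ I → 𝟙 (does (J ≟ˢ I))

multiplicity-filter : ∀ {n p} {P : Pred (Subset n) p} (P? : Decidable P) {J} → P J → ∀ xs →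
                      multiplicity J (filter P? xs) ≡ multiplicity J xs
multiplicity-filter P? {J} PJ []       = refl
multiplicity-filter P? {J} PJ (I ∷ xs) with P? I
... | yes _  = cong (𝟙 (does (J ≟ˢ I)) +_) (multiplicity-filter P? PJ xs)
... | no ¬PI with J ≟ˢ I
...   | yes refl = contradiction PJ ¬PI
...   | no _     = multiplicity-filter P? PJ xs

-- Only the half of the list whose first entry matches `s` contributes, and there the tail `J`
-- occurs once by induction.
multiplicity-subsets : ∀ {n} (J : Subset n) → multiplicity J (subsets n) ≡ 1
multiplicity-subsets         []      = refl
multiplicity-subsets {suc n} (s ∷ J) = trans
  (∑ᴸ-++ _ (map (inside ∷_) (subsets n)) (map (outside ∷_) (subsets n)))
  (trans (cong₂ _+_ (heads s inside (subsets n)) (heads s outside (subsets n))) (split s))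
  where
  heads : ∀ s t xs → multiplicity (s ∷ J) (map (t ∷_) xs) ≡ 𝟙 (does (s Bool.≟ t)) * multiplicity J xs
  heads s t []       = sym (*-zeroʳ (𝟙 (does (s Bool.≟ t))))
  heads s t (I ∷ xs) = trans (cong (_ +_) (heads s t xs)) (factor (does (s Bool.≟ t)) (does (J ≟ˢ I)))
    where
    factor : ∀ b c → 𝟙 (b ∧ c) + 𝟙 b * multiplicity J xs ≡ 𝟙 b * (𝟙 c + multiplicity J xs)
    factor true  c = trans (cong (𝟙 c +_) (+-identityʳ _)) (sym (+-identityʳ _))
    factor false c = refl
  split : ∀ s → 𝟙 (does (s Bool.≟ inside)) * multiplicity J (subsets n) +
                𝟙 (does (s Bool.≟ outside)) * multiplicity J (subsets n) ≡ 1
  split true  = trans (+-identityʳ _) (trans (+-identityʳ _) (multiplicity-subsets J))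
  split false = trans (+-identityʳ _) (multiplicity-subsets J)

-- Natural numbers and natural multiples in the rationals.

ι : ℕ → ℚ
ι n = ℤ.+ n ℚ./ 1

private
  ι≃ : ∀ n → toℚᵘ (ι n) ℚᵘ.≃ mkℚᵘ (ℤ.+ n) 0
  ι≃ n = ℚ.toℚᵘ-fromℚᵘ (mkℚᵘ (ℤ.+ n) 0)

ι-mono : ∀ {m n} → m ≤ n → ι m ℚ.≤ ι n
ι-mono {m} {n} m≤n = ℚ.toℚᵘ-cancel-≤ (begin
  toℚᵘ (ι m)        ≃⟨ ι≃ m ⟩
  mkℚᵘ (ℤ.+ m) 0    ≤⟨ *≤* (ℤ.*-monoʳ-≤-nonNeg (ℤ.+ 1) (ℤ.+≤+ m≤n)) ⟩
  mkℚᵘ (ℤ.+ n) 0    ≃⟨ ι≃ n ⟨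
  toℚᵘ (ι n)        ∎)
  where open ℚᵘ.≤-Reasoning

ι-+ : ∀ m n → ι (m + n) ≡ ι m ℚ.+ ι n
ι-+ m n = ℚ.toℚᵘ-injective (begin-equality
  toℚᵘ (ι (m + n))                          ≃⟨ ι≃ (m + n) ⟩
  mkℚᵘ (ℤ.+ (m + n)) 0                      ≃⟨ *≡* (cong (ℤ._* ℤ.+ 1) numerators) ⟩
  mkℚᵘ (ℤ.+ m) 0 ℚᵘ.+ mkℚᵘ (ℤ.+ n) 0        ≃⟨ ℚᵘ.+-cong (ι≃ m) (ι≃ n) ⟨
  toℚᵘ (ι m) ℚᵘ.+ toℚᵘ (ι n)                ≃⟨ ℚ.toℚᵘ-homo-+ (ι m) (ι n) ⟨
  toℚᵘ (ι m ℚ.+ ι n)                        ∎)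
  where
  open ℚᵘ.≤-Reasoning
  numerators : ℤ.+ (m + n) ≡ (ℤ.+ m ℤ.* ℤ.+ 1) ℤ.+ (ℤ.+ n ℤ.* ℤ.+ 1)
  numerators = sym (cong₂ ℤ._+_ (ℤ.*-identityʳ (ℤ.+ m)) (ℤ.*-identityʳ (ℤ.+ n)))

ι-· : ∀ n → n · 1ℚ ≡ ι n
ι-· zero    = refl
ι-· (suc n) = trans (cong (1ℚ ℚ.+_) (ι-· n)) (sym (ι-+ 1 n))

ι-∑ᴸ : ∀ {A : Set} (g : A → ℕ) xs → ℚᴸ.∑ᴸ (ι ∘ g) xs ≡ ι (∑ᴸ g xs)
ι-∑ᴸ g []       = refl
ι-∑ᴸ g (x ∷ xs) = trans (cong (ι (g x) ℚ.+_) (ι-∑ᴸ g xs)) (sym (ι-+ (g x) _))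

·-zeroʳ : ∀ n → n · 0ℚ ≡ 0ℚ
·-zeroʳ zero    = refl
·-zeroʳ (suc n) = trans (ℚ.+-identityˡ _) (·-zeroʳ n)

·-mono-< : ∀ n .{{_ : NonZero n}} {p q} → p ℚ.< q → n · p ℚ.< n · q
·-mono-< (suc zero)    p<q = ℚ.+-mono-<-≤ p<q ℚ.≤-refl
·-mono-< (suc (suc n)) p<q = ℚ.+-mono-< p<q (·-mono-< (suc n) p<q)

·-cancel-≤ : ∀ n .{{_ : NonZero n}} {p q} → n · p ℚ.≤ n · q → p ℚ.≤ q
·-cancel-≤ n np≤nq = ℚ.≮⇒≥ λ q<p → ℚ.<-irrefl refl (ℚ.<-≤-trans (·-mono-< n q<p) np≤nq)

·-distrib-+ : ∀ n p q → n · (p ℚ.+ q) ≡ n · p ℚ.+ n · q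
·-distrib-+ n p q = begin
  n · (p ℚ.+ q)                               ≡⟨ ℚꟳ.sum-replicate n ⟨
  ℚꟳ.sum {n} (λ _ → p ℚ.+ q)                  ≡⟨ ℚꟳ.∑-distrib-+ {n} (λ _ → p) (λ _ → q) ⟩
  ℚꟳ.sum {n} (λ _ → p) ℚ.+ ℚꟳ.sum {n} (λ _ → q) ≡⟨ cong₂ ℚ._+_ (ℚꟳ.sum-replicate n) (ℚꟳ.sum-replicate n) ⟩
  n · p ℚ.+ n · q                             ∎
  where open ≡-Reasoning

∑ᴸ-· : ∀ n {A : Set} (f : A → ℚ) xs → ℚᴸ.∑ᴸ (λ x → n · f x) xs ≡ n · ℚᴸ.∑ᴸ f xs
∑ᴸ-· n f []       = sym (·-zeroʳ n)
∑ᴸ-· n f (x ∷ xs) = trans (cong (n · f x ℚ.+_) (∑ᴸ-· n f xs)) (sym (·-distrib-+ n (f x) _))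

-- The ordering of reals seen on representing sequences: seq x ≲ seq y wraps x ℝ.≤ y, with
-- arguments that can be inferred.
infix 4 _≲_
record _≲_ (x y : ℕ → ℚ) : Set where
  constructor ≲⁺
  field ≲⁻ : ∀ ε → 0ℚ ℚ.< ε → ∃[ N ] (∀ n → N ≤ n → x n ℚ.≤ y n ℚ.+ ε)

open _≲_

private
  ½+½ : ∀ ε → ½ ℚ.* ε ℚ.+ ½ ℚ.* ε ≡ ε
  ½+½ ε = trans (sym (ℚ.*-distribʳ-+ ε ½ ½)) (ℚ.*-identityˡ ε)

  0<½ : ∀ {ε} → 0ℚ ℚ.< ε → 0ℚ ℚ.< ½ ℚ.* ε
  0<½ {ε} 0<ε = subst (ℚ._< ½ ℚ.* ε) (ℚ.*-zeroʳ ½) (ℚ.*-monoʳ-<-pos ½ 0<ε)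

pointwise : ∀ {x y} → (∀ n → x n ℚ.≤ y n) → x ≲ y
pointwise {x} {y} x≤y = ≲⁺ λ ε 0<ε → 0 , λ n _ → begin
  x n              ≤⟨ x≤y n ⟩
  y n              ≡⟨ ℚ.+-identityʳ (y n) ⟨
  y n ℚ.+ 0ℚ       ≤⟨ ℚ.+-monoʳ-≤ (y n) (ℚ.<⇒≤ 0<ε) ⟩
  y n ℚ.+ ε        ∎
  where open ℚ.≤-Reasoning

≲-reflexive : ∀ {x y} → x ≗ y → x ≲ y
≲-reflexive x≡y = pointwise λ n → ℚ.≤-reflexive (x≡y n)

≲-trans : ∀ {x y z} → x ≲ y → y ≲ z → x ≲ z
≲-trans {x} {y} {z} (≲⁺ x≤y) (≲⁺ y≤z) = ≲⁺ λ ε 0<ε →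
  let M , x≤ = x≤y (½ ℚ.* ε) (0<½ 0<ε)
      N , y≤ = y≤z (½ ℚ.* ε) (0<½ 0<ε)
  in M ⊔ N , λ n n≥ → begin
    x n                              ≤⟨ x≤ n (≤-trans (m≤m⊔n M N) n≥) ⟩
    y n ℚ.+ ½ ℚ.* ε                  ≤⟨ ℚ.+-monoˡ-≤ (½ ℚ.* ε) (y≤ n (≤-trans (m≤n⊔m M N) n≥)) ⟩
    z n ℚ.+ ½ ℚ.* ε ℚ.+ ½ ℚ.* ε      ≡⟨ ℚ.+-assoc (z n) _ _ ⟩
    z n ℚ.+ (½ ℚ.* ε ℚ.+ ½ ℚ.* ε)    ≡⟨ cong (z n ℚ.+_) (½+½ ε) ⟩
    z n ℚ.+ ε                        ∎
  where open ℚ.≤-Reasoning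

+-mono-≲ : ∀ {x y u v} → x ≲ y → u ≲ v → (λ n → x n ℚ.+ u n) ≲ (λ n → y n ℚ.+ v n)
+-mono-≲ {x} {y} {u} {v} (≲⁺ x≤y) (≲⁺ u≤v) = ≲⁺ λ ε 0<ε →
  let M , x≤ = x≤y (½ ℚ.* ε) (0<½ 0<ε)
      N , u≤ = u≤v (½ ℚ.* ε) (0<½ 0<ε)
  in M ⊔ N , λ n n≥ → begin
    x n ℚ.+ u n
      ≤⟨ ℚ.+-mono-≤ (x≤ n (≤-trans (m≤m⊔n M N) n≥)) (u≤ n (≤-trans (m≤n⊔m M N) n≥)) ⟩
    (y n ℚ.+ ½ ℚ.* ε) ℚ.+ (v n ℚ.+ ½ ℚ.* ε)
      ≡⟨ ℚ-interchange (y n) (½ ℚ.* ε) (v n) (½ ℚ.* ε) ⟩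
    (y n ℚ.+ v n) ℚ.+ (½ ℚ.* ε ℚ.+ ½ ℚ.* ε)
      ≡⟨ cong ((y n ℚ.+ v n) ℚ.+_) (½+½ ε) ⟩
    (y n ℚ.+ v n) ℚ.+ ε ∎
  where open ℚ.≤-Reasoning

∑ᴸ-mono-≲ : ∀ {A : Set} (f g : A → ℕ → ℚ) {xs} → All (λ x → f x ≲ g x) xs →
            (λ j → ℚᴸ.∑ᴸ (λ x → f x j) xs) ≲ (λ j → ℚᴸ.∑ᴸ (λ x → g x j) xs)
∑ᴸ-mono-≲ f g []           = ≲-reflexive λ _ → refl
∑ᴸ-mono-≲ f g (f≲g ∷ rest) = +-mono-≲ f≲g (∑ᴸ-mono-≲ f g rest)

∑ꟳ-mono-≲ : ∀ {n} (f g : Fin n → ℕ → ℚ) → (∀ i → f i ≲ g i) →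
            (λ j → ℚꟳ.sum (λ i → f i j)) ≲ (λ j → ℚꟳ.sum (λ i → g i j))
∑ꟳ-mono-≲ {zero}  f g f≲g = ≲-reflexive λ _ → refl
∑ꟳ-mono-≲ {suc n} f g f≲g = +-mono-≲ (f≲g zero) (∑ꟳ-mono-≲ (f ∘ suc) (g ∘ suc) (f≲g ∘ suc))

-- The `n - m` additional copies of `x` are nonnegative in the limit.
·-monoˡ-≲ : ∀ {m n x} → (λ _ → 0ℚ) ≲ x → m ≤ n → (λ j → m · x j) ≲ (λ j → n · x j)
·-monoˡ-≲ {zero}  {zero}  0≲x z≤n       = ≲-reflexive λ _ → refl
·-monoˡ-≲ {zero}  {suc n} 0≲x z≤n       = +-mono-≲ 0≲x (·-monoˡ-≲ {zero} {n} 0≲x z≤n)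
·-monoˡ-≲ {suc m} {suc n} {x} 0≲x (s≤s m≤n) = +-mono-≲ (≲-reflexive {x} λ _ → refl) (·-monoˡ-≲ 0≲x m≤n)

·-cancelˡ-≲ : ∀ n .{{_ : NonZero n}} {x y} → (λ j → n · x j) ≲ (λ j → n · y j) → x ≲ y
·-cancelˡ-≲ n {x} {y} (≲⁺ nx≤ny) = ≲⁺ λ ε 0<ε →
  -- Tolerance `n · ε` on the multiples becomes `ε` after cancelling `n`.
  let M , nx≤ = nx≤ny (n · ε) (subst (ℚ._< n · ε) (·-zeroʳ n) (·-mono-< n 0<ε))
  in M , λ j j≥ → ·-cancel-≤ n (begin
    n · x j                 ≤⟨ nx≤ j j≥ ⟩
    n · y j ℚ.+ n · ε       ≡⟨ ·-distrib-+ n (y j) ε ⟨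
    n · (y j ℚ.+ ε)         ∎)
  where open ℚ.≤-Reasoning

seq-∑ : ∀ {A : Set} (f : A → ℝ) xs n → seq (∑ f xs) n ≡ ℚᴸ.∑ᴸ (λ x → seq (f x) n) xs
seq-∑ f []       n = refl
seq-∑ f (x ∷ xs) n = cong (seq (f x) n ℚ.+_) (seq-∑ f xs n)

-- Chromatic numbers of a graph on `n * m` vertices with `m` colours and independent sets of size at
-- most `n`.

module Balanced {N m n : ℕ} .{{_ : NonZero n}} (G : Graph N)
  (full : ∀ x → x ∈ V G) (N≡n*m : N ≡ n * m)
  (hue : Fin N → Fin m) (proper : ∀ {x y} → Graph.Adj G x y → hue x ≢ hue y)
  (bounded : ∀ I → Independent G I → ∣ I ∣ ≤ n) where

  class : Fin m → Subset N
  class c = ⟪ (λ x → c Fin.≟ hue x) ⟫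

  class-independent : ∀ c → Independent G (class c)
  class-independent c = (λ {x} _ → full x) , λ x y x∈ y∈ a →
    proper a (trans (sym (∈⟪⟫⁻ (λ x → c Fin.≟ hue x) x∈)) (∈⟪⟫⁻ (λ x → c Fin.≟ hue x) y∈))

  -- The fibres of a colouring with `c` colours are independent, so they cover at most `c * n` of
  -- the `n * m` vertices.
  chromaticNumber : IsChromaticNumber G m
  chromaticNumber = ((λ u → hue (proj₁ u)) , λ _ _ → proper) , λ c (f , f-proper) → *-cancelˡ-≤ n (begin
    n * m                                                ≡⟨ N≡n*m ⟨
    N                                                    ≡⟨ *-identityʳ N ⟨
    N * 1                                                ≡⟨ ∑-const N 1 ⟨
    ∑[ x < N ] 1                                         ≡⟨ ∑-fibres (λ x → f (x , full x)) (λ _ → 1) ⟩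
    ∑[ a < c ] ∑[ x < N ] (𝟙 (does (f (x , full x) Fin.≟ a)) * 1)
      ≡⟨ (sum-cong-≗ λ a → sum-cong-≗ λ x → *-identityʳ (𝟙 (does (f (x , full x) Fin.≟ a)))) ⟩
    ∑[ a < c ] ∑[ x < N ] 𝟙 (does (f (x , full x) Fin.≟ a))
      ≡⟨ (sum-cong-≗ λ a → ∣⟪⟫∣ (λ x → f (x , full x) Fin.≟ a)) ⟨
    ∑[ a < c ] ∣ ⟪ (λ x → f (x , full x) Fin.≟ a) ⟫ ∣
      ≤⟨ ∑-mono (λ a → bounded _ (fibre-independent f f-proper a)) ⟩
    ∑[ a < c ] n                                         ≡⟨ ∑-const c n ⟩
    c * n                                                ≡⟨ *-comm c n ⟩
    n * c                                                ∎)
    where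
    open ≤-Reasoning
    fibre-independent : ∀ {c} (f : Vertex G → Fin c) →
      (∀ u v → Graph.Adj G (proj₁ u) (proj₁ v) → f u ≢ f v) →
      ∀ a → Independent G ⟪ (λ x → f (x , full x) Fin.≟ a) ⟫
    fibre-independent f f-proper a = (λ {x} _ → full x) , λ x y x∈ y∈ adj →
      f-proper (x , full x) (y , full y) adj
        (trans (∈⟪⟫⁻ (λ x → f (x , full x) Fin.≟ a) x∈) (sym (∈⟪⟫⁻ (λ x → f (x , full x) Fin.≟ a) y∈)))

  private
    -- Counting the colours whose class is `I`, rather than testing whether there is one, makes the
    -- total `m` by exchanging two sums.
    classWeight : Subset N → ℕ
    classWeight I = ∑[ c < m ] 𝟙 (does (class c ≟ˢ I))

    ∑-classWeight : ∀ xs → seq (∑ (fromℕ ∘ classWeight) xs) ≗ λ _ → ι (∑[ c < m ] multiplicity (class c) xs)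
    ∑-classWeight xs j = trans (seq-∑ (fromℕ ∘ classWeight) xs j)
      (trans (ι-∑ᴸ classWeight xs) (cong ι (∑ᴸ-comm (λ I c → 𝟙 (does (class c ≟ˢ I))) xs)))

    multiplicity-independentSets : ∀ c → multiplicity (class c) (independentSets G) ≡ 1
    multiplicity-independentSets c =
      trans (multiplicity-filter (independent? G) (class-independent c) (subsets N)) (multiplicity-subsets (class c))

    classWeight-colouring : IsFractionalColouring G (fromℕ ∘ classWeight)
    classWeight-colouring =
      (λ I _ → ≲⁻ (pointwise {λ _ → 0ℚ} {λ _ → ι (classWeight I)} λ _ → ι-mono {0} {classWeight I} z≤n)) ,
      λ v _ → ≲⁻ (pointwise {λ _ → 1ℚ} λ j → subst (ι 1 ℚ.≤_) (sym (∑-classWeight (filter (v ∈?_) (independentSets G)) j)) (ι-mono (covers v)))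
      where
      -- The class of the hue of `v` alone contributes 1.
      covers : ∀ v → 1 ≤ ∑[ c < m ] multiplicity (class c) (filter (v ∈?_) (independentSets G))
      covers v = ≤-trans (≤-reflexive (sym (trans
        (multiplicity-filter (v ∈?_) (∈⟪⟫⁺ (λ x → hue v Fin.≟ hue x) refl) (independentSets G))
        (multiplicity-independentSets (hue v)))))
        (∑-term (λ c → multiplicity (class c) (filter (v ∈?_) (independentSets G))) (hue v))

    ∑-classWeight-total : seq (∑ (fromℕ ∘ classWeight) (independentSets G)) ≗ λ _ → ι m
    ∑-classWeight-total j = trans (∑-classWeight (independentSets G) j) (cong ι (begin
      ∑[ c < m ] multiplicity (class c) (independentSets G)  ≡⟨ sum-cong-≗ multiplicity-independentSets ⟩
      ∑[ c < m ] 1                                           ≡⟨ ∑-const m 1 ⟩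
      m * 1                                                  ≡⟨ *-identityʳ m ⟩
      m                                                      ∎))
      where open ≡-Reasoning

    members : ∀ {N} (I : Subset N) p → ℚꟳ.sum (λ v → if does (v ∈? I) then p else 0ℚ) ≡ ∣ I ∣ · p
    members []            p = refl
    members (inside ∷ I)  p = cong (p ℚ.+_) (members I p)
    members (outside ∷ I) p = trans (ℚ.+-identityˡ _) (members I p)

    module _ (w : Subset N → ℝ) (w-colouring : IsFractionalColouring G w) where

      private
        total : ℝ
        total = ∑ w (independentSets G)

        cover : Fin N → ℝ
        cover v = ∑ w (filter (v ∈?_) (independentSets G))

        ones : (λ j → n · ι m) ≲ (λ j → ℚꟳ.sum {N} λ v → 1ℚ)
        ones = ≲-reflexive λ j → begin
          n · ι m                 ≡⟨ cong (n ·_) (ι-· m) ⟨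
          n · (m · 1ℚ)            ≡⟨ ·-assocˡ 1ℚ n m ⟩
          (n * m) · 1ℚ            ≡⟨ cong (_· 1ℚ) N≡n*m ⟨
          N · 1ℚ                  ≡⟨ ℚꟳ.sum-replicate N ⟨
          ℚꟳ.sum {N} (λ v → 1ℚ)   ∎
          where open ≡-Reasoning

        covered : (λ j → ℚꟳ.sum {N} λ v → 1ℚ) ≲ (λ j → ℚꟳ.sum λ v → seq (cover v) j)
        covered = ∑ꟳ-mono-≲ (λ v j → 1ℚ) (λ v → seq (cover v)) λ v → ≲⁺ (proj₂ w-colouring v (full v))

        double-count : (λ j → ℚꟳ.sum λ v → seq (cover v) j) ≲
                       (λ j → ℚᴸ.∑ᴸ (λ I → ∣ I ∣ · seq (w I) j) (independentSets G))
        double-count = ≲-reflexive λ j → begin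
          ℚꟳ.sum (λ v → seq (cover v) j)
            ≡⟨ ℚꟳ.sum-cong-≗ (λ v → trans (seq-∑ w (filter (v ∈?_) (independentSets G)) j)
                 (ℚᴸ.∑ᴸ-filter (v ∈?_) (λ I → seq (w I) j) (independentSets G))) ⟩
          ℚꟳ.sum (λ v → ℚᴸ.∑ᴸ (λ I → if does (v ∈? I) then seq (w I) j else 0ℚ) (independentSets G))
            ≡⟨ ℚᴸ.∑ᴸ-comm (λ I v → if does (v ∈? I) then seq (w I) j else 0ℚ) (independentSets G) ⟨
          ℚᴸ.∑ᴸ (λ I → ℚꟳ.sum (λ v → if does (v ∈? I) then seq (w I) j else 0ℚ)) (independentSets G)
            ≡⟨ ℚᴸ.∑ᴸ-cong (λ I → members I (seq (w I) j)) (independentSets G) ⟩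
          ℚᴸ.∑ᴸ (λ I → ∣ I ∣ · seq (w I) j) (independentSets G) ∎
          where open ≡-Reasoning

        -- Replacing `∣ I ∣` by `n` uses that the weights of independent sets are nonnegative.
        size-bound : (λ j → ℚᴸ.∑ᴸ (λ I → ∣ I ∣ · seq (w I) j) (independentSets G)) ≲
                     (λ j → ℚᴸ.∑ᴸ (λ I → n · seq (w I) j) (independentSets G))
        size-bound = ∑ᴸ-mono-≲ (λ I j → ∣ I ∣ · seq (w I) j) (λ I j → n · seq (w I) j) (All.map
          (λ {I} ind → ·-monoˡ-≲ (≲⁺ (proj₁ w-colouring I ind)) (bounded I ind))
          (all-filter (independent? G) (subsets N)))

        collect : (λ j → ℚᴸ.∑ᴸ (λ I → n · seq (w I) j) (independentSets G)) ≲ (λ j → n · seq total j)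
        collect = ≲-reflexive λ j → begin
          ℚᴸ.∑ᴸ (λ I → n · seq (w I) j) (independentSets G)   ≡⟨ ∑ᴸ-· n (λ I → seq (w I) j) (independentSets G) ⟩
          n · ℚᴸ.∑ᴸ (λ I → seq (w I) j) (independentSets G)   ≡⟨ cong (n ·_) (seq-∑ w (independentSets G) j) ⟨
          n · seq total j                                     ∎
          where open ≡-Reasoning

      -- Summing the covering condition over all `n * m` vertices counts each weight `w I` exactly
      -- `∣ I ∣` times, hence gives `n * m` at most `n` times the total weight; then `n` cancels.
      total-bound : (λ j → ι m) ≲ seq total
      total-bound = ·-cancelˡ-≲ n
        (≲-trans ones (≲-trans covered (≲-trans double-count (≲-trans size-bound collect))))

  fractionalChromaticNumber : IsFractionalChromaticNumber G (fromℕ m)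
  fractionalChromaticNumber =
    (fromℕ ∘ classWeight , classWeight-colouring ,
      ≲⁻ (≲-reflexive ∑-classWeight-total) , ≲⁻ (≲-reflexive (sym ∘ ∑-classWeight-total))) ,
    λ r (w , w-colouring , total≤r , _) → ≲⁻ (≲-trans (total-bound w w-colouring) (≲⁺ {y = seq r} total≤r))

-- The ratio of order to independence number, and the choice of parameters.

n*m/n : ∀ n m .{{_ : NonZero n}} → ℤ.+ (n * m) ℚ./ n ≡ ℤ.+ m ℚ./ 1
n*m/n n@(suc n-1) m = ℚ.fromℚᵘ-cong {mkℚᵘ (ℤ.+ (n * m)) n-1} {mkℚᵘ (ℤ.+ m) 0}
  (*≡* (trans (ℤ.*-identityʳ (ℤ.+ (n * m))) (trans (cong ℤ.+_ (*-comm n m)) (ℤ.pos-* m n))))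

open import Data.Integer using (+_)
open import Data.Rational using (_/_)

theorem2 : (k d : ℕ) .{{_ : NonZero k}} .{{_ : NonZero d}} →
    ∃[ N ] Σ (Graph N) λ G →
    (Σ (Fin d → Graph N) λ H → (∀ i → IsComparabilityGraph (H i)) × IsUnion G H) ×
    IsCliqueNumber G k ×
    (∃[ α ] Σ (NonZero α) λ α≢0 →
    IsIndependenceNumber G α × (_/_ (+ ∣ V G ∣) α {{α≢0}} ≡ + (k ^ d) / 1)) ×
    IsFractionalChromaticNumber G (fromℕ (k ^ d)) ×
    IsChromaticNumber G (k ^ d)
theorem2 k@(suc _) d@(suc _) =
  N , graph ,
  (layer , comparability , union zero) ,
  cliqueNumber far zero (λ _ ()) ,
  (n , nonZero-n ,
    ((class c₀ , class-independent c₀ , ∣class∣ c₀) ,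
     λ { _ (I , independent , refl) → bounded I independent }) ,
    trans (ℚ./-cong {q₁ = n} (cong ℤ.+_ (∣⊤∣≡n N)) refl) (n*m/n n m)) ,
  fractionalChromaticNumber ,
  chromaticNumber
  where
  m = k ^ d
  -- D is least such that 3kr < D; then r² ≥ 2Dm² as soon as r ≥ 2m²(3k + 1).
  r = 2 * (m * m) * (3 * k + 1)
  D = 3 * k * r + 1
  n = k ^ D
  open Construction k d D r

  far : 3 * k * r < D
  far = ≤-reflexive (sym (+-comm (3 * k * r) 1))

  instance
    nonZero-n : NonZero n
    nonZero-n = m^n≢0 k D
    nonZero-D : NonZero D
    nonZero-D = >-nonZero (≤-trans (s≤s z≤n) far)
    nonZero-m : NonZero m
    nonZero-m = m^n≢0 k d
    nonZero-r : NonZero r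
    nonZero-r = m*n≢0 (2 * (m * m)) (3 * k + 1) {{m*n≢0 2 (m * m) {{_}} {{m*n≢0 m m}}}} {{>-nonZero (m≤n+m 1 (3 * k))}}

  r-large : m * m * (2 * D) ≤ r * r
  r-large = begin
    -- By `1 ≤ r` the final 1 may be raised to `r`; the factor left beside `r` is then the
    -- definition of `r`.
    m * m * (2 * (3 * k * r + 1))   ≤⟨ *-monoʳ-≤ (m * m) (*-monoʳ-≤ 2 (+-monoʳ-≤ (3 * k * r) (>-nonZero⁻¹ r))) ⟩
    m * m * (2 * (3 * k * r + r))   ≡⟨ identity (m * m) (3 * k) r ⟩
    r * r                           ∎
    where
    open ≤-Reasoning
    identity : ∀ a b r → a * (2 * (b * r + r)) ≡ 2 * a * (b + 1) * r
    identity = solve-∀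

  bounded = ∣independent∣≤ r-large
  -- All colour classes have size `n`; the colour `(0,…,0)` serves as the witness that this size is
  -- attained.
  c₀ = index (replicate d zero)
  open Balanced graph (λ _ → ∈⊤) refl hue hue-proper bounded

  ∣class∣ : ∀ c → ∣ class c ∣ ≡ n
  ∣class∣ c = begin
    ∣ class c ∣                                                    ≡⟨ ∣⟪⟫∣ (λ x → c Fin.≟ hue x) ⟩
    ∑[ x < N ] 𝟙 (does (c Fin.≟ hue x))                            ≡⟨ ∑-combine n m (λ x → 𝟙 (does (c Fin.≟ hue x))) ⟩
    ∑[ i < n ] ∑[ c′ < m ] 𝟙 (does (c Fin.≟ hue (combine i c′)))   ≡⟨ (sum-cong-≗ λ i → one i) ⟩
    ∑[ i < n ] 1                                                   ≡⟨ ∑-const n 1 ⟩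
    n * 1                                                          ≡⟨ *-identityʳ n ⟩
    n                                                              ∎
    where
    open ≡-Reasoning
    one : ∀ i → ∑[ c′ < m ] 𝟙 (does (c Fin.≟ hue (combine i c′))) ≡ 1
    one i = trans
      (sum-cong-≗ λ c′ → trans (cong (λ h → 𝟙 (does (c Fin.≟ h))) (hue-combine i c′)) (sym (*-identityʳ _)))
      (∑-𝟙-≟ (λ _ → 1) c)
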